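{- Let $k\in\{9,10,11\}$. Then the set of odd positive integers $n$ with $s(n)=s(n^2)=k$ is finite.
   Context: For a nonnegative integer $n$, $s(n)$ denotes the sum of the digits of $n$ in base $2$ (the number of $1$'s in the binary expansion of $n$). -}

module Defs where

open import Data.Nat using (ℕ; zero; suc; _+_)
open import Data.Nat.DivMod using (_/_; _%_)

-- binary digit sum with fuel; fuel ≥ n suffices (n / 2 < n for n > 0)
s-fuel : ℕ → ℕ → ℕ
s-fuel zero    n = 0
s-fuel (suc f) n = n % 2 + s-fuel f (n / 2)

s : ℕ → ℕ
s n = s-fuel n n

{-# OPTIONS --safe #-}
module Submission where

open import Defs
open import Data.Nat
open import Data.Nat.Properties
open import Data.Nat.DivMod
open import Data.Nat.Divisibility using (divides)
open import Data.Nat.Induction using (<-wellFounded)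
open import Data.Nat.Tactic.RingSolver using (solve-∀)
open import Data.Bool using (Bool; true; false; _∧_; T)
open import Data.Empty using (⊥-elim)
open import Data.List using (List; []; _∷_; _++_; map; length)
open import Data.List.Membership.Propositional using (_∈_)
open import Data.List.Membership.Propositional.Properties using (∈-map⁺)
open import Data.List.Properties using (length-map)
open import Data.List.Relation.Unary.All using (All; []; _∷_)
open import Data.List.Relation.Unary.Any using (here; there)
open import Data.Maybe using (Maybe; just; nothing)
open import Data.Product using (∃-syntax; _×_; _,_; proj₁; proj₂)
open import Data.Sum using (_⊎_; inj₁; inj₂)
open import Data.Unit using (tt)
open import Function using (_∘_)
open import Induction.WellFounded using (Acc; acc)
open import Relation.Nullary using (yes; no)
open import Relation.Binary.PropositionalEquality

-- Describe an odd n with k ones by the k - 1 gaps between consecutive ones. The exponents of the powers of two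
-- that make up n² are then linear forms in the gaps. If n is huge, a pigeonhole argument on thresholds makes some
-- gaps arbitrarily large compared with all the others. For each of the finitely many ways of declaring the gaps
-- small or large (not all small), n² is added up symbolically: equal exponents merge (a carry), an exponent below
-- all remaining ones gives a digit 1, and a sum whose parts are far apart falls into independent groups. When two
-- exponents cannot be compared, the search branches on the order of two gaps; two large gaps may also differ by
-- an amount that counts as a new small variable. For k ≤ 11 every branch ends with more than k digits, which is
-- checked by evaluation, so s n ≡ s (n * n) ≡ k forces all gaps to be bounded.

-- Binary digit sums

half-≤ : ∀ n f → n ≤ suc f → n / 2 ≤ f
half-≤ zero f _ = z≤n
half-≤ (suc n) f (s≤s n≤f) = ≤-trans (s≤s⁻¹ (m/n<m (suc n) 2 (s≤s (s≤s z≤n)))) n≤f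

-- After one halving the fuel left over no longer equals the argument; independence of the fuel is
-- what lets `s-unfold` return to `s`.
s-fuel-irrelevant : ∀ f g n → n ≤ f → n ≤ g → s-fuel f n ≡ s-fuel g n
s-fuel-irrelevant zero zero _ _ _ = refl
s-fuel-irrelevant zero (suc g) zero _ _ = s-fuel-irrelevant zero g 0 z≤n z≤n
s-fuel-irrelevant (suc f) zero zero _ _ = s-fuel-irrelevant f zero 0 z≤n z≤n
s-fuel-irrelevant (suc f) (suc g) n n≤f n≤g =
  cong (n % 2 +_) (s-fuel-irrelevant f g (n / 2) (half-≤ n f n≤f) (half-≤ n g n≤g))

s-unfold : ∀ n → s n ≡ n % 2 + s (n / 2)
s-unfold zero = refl
s-unfold (suc n) = cong (suc n % 2 +_)
  (s-fuel-irrelevant n (suc n / 2) (suc n / 2) (half-≤ (suc n) n ≤-refl) ≤-refl)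

bit+2* : ∀ b m → b < 2 → s (b + 2 * m) ≡ b + s m
bit+2* b m b<2 = trans (s-unfold (b + 2 * m)) (cong₂ (λ x y → x + s y) rem quo)
  where
  comm : b + 2 * m ≡ b + m * 2
  comm = cong (b +_) (*-comm 2 m)
  rem : (b + 2 * m) % 2 ≡ b
  rem = trans (cong (_% 2) comm) (trans ([m+kn]%n≡m%n b m 2) (m<n⇒m%n≡m b<2))
  quo : (b + 2 * m) / 2 ≡ m
  quo = trans (cong (_/ 2) comm) (trans (+-distrib-/-∣ʳ b (divides m refl))
          (cong₂ _+_ (m<n⇒m/n≡0 b<2) (m*n/n≡m m 2)))

s-double : ∀ m → s (2 * m) ≡ s m
s-double m = bit+2* 0 m (s≤s z≤n)

s-suc-double : ∀ m → s (suc (2 * m)) ≡ suc (s m)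
s-suc-double m = bit+2* 1 m (s≤s (s≤s z≤n))

-- Since `l` occupies only the lowest `a` positions, no carry occurs. The induction strips the
-- lowest bit of `l`. Every later additivity of digit sums goes back to this lemma.
s-split : ∀ a l m → l < 2 ^ a → s (l + 2 ^ a * m) ≡ s l + s m
s-split zero zero m _ = cong s (*-identityˡ m)
s-split zero (suc _) m (s≤s ())
s-split (suc a) l m l<2ᵃ = begin
  s (l + 2 ^ suc a * m)                     ≡⟨ cong s (regroup l) ⟩
  s (l % 2 + 2 * (l / 2 + 2 ^ a * m))       ≡⟨ bit+2* (l % 2) (l / 2 + 2 ^ a * m) (m%n<n l 2) ⟩
  l % 2 + s (l / 2 + 2 ^ a * m)             ≡⟨ cong (l % 2 +_) (s-split a (l / 2) m (m<n*o⇒m/o<n (subst (l <_) (*-comm 2 (2 ^ a)) l<2ᵃ))) ⟩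
  l % 2 + (s (l / 2) + s m)                 ≡⟨ +-assoc (l % 2) _ _ ⟨
  l % 2 + s (l / 2) + s m                   ≡⟨ cong (_+ s m) (s-unfold l) ⟨
  s l + s m                                 ∎
  where
  open ≡-Reasoning
  ring : ∀ r q p m → r + q * 2 + 2 * p * m ≡ r + 2 * (q + p * m)
  ring = solve-∀
  regroup : ∀ l → l + 2 ^ suc a * m ≡ l % 2 + 2 * (l / 2 + 2 ^ a * m)
  regroup l = trans (cong (_+ 2 ^ suc a * m) (m≡m%n+[m/n]*n l 2)) (ring (l % 2) (l / 2) (2 ^ a) m)

s-shift : ∀ a m → s (2 ^ a * m) ≡ s m
s-shift a m = s-split a 0 m (m^n>0 2 a)

s>0 : ∀ n → 0 < n → 0 < s n
s>0 n = go n (<-wellFounded n)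
  where
  go : ∀ n → Acc _<_ n → 0 < n → 0 < s n
  go (suc n) (acc rs) _ with suc n % 2 in r | s-unfold (suc n)
  ... | suc _ | eq = subst (0 <_) (sym eq) (s≤s z≤n)
  ... | zero | eq = subst (0 <_) (sym eq) (go (suc n / 2) (rs (m/n<m (suc n) 2 (s≤s (s≤s z≤n)))) (n≢0⇒n>0 half≢0))
    where
    half≢0 : suc n / 2 ≢ 0
    half≢0 h with trans (m≡m%n+[m/n]*n (suc n) 2) (cong₂ (λ x y → x + y * 2) r h)
    ... | ()

n<2^n : ∀ n → n < 2 ^ n
n<2^n zero = s≤s z≤n
n<2^n (suc n) = begin
  suc (suc n)   ≤⟨ +-mono-≤ (m^n>0 2 n) (n<2^n n) ⟩
  2 ^ n + 2 ^ n ≡⟨ cong (2 ^ n +_) (+-identityʳ (2 ^ n)) ⟨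
  2 ^ suc n     ∎
  where open ≤-Reasoning

-- Symbolic sums of powers of two

-- form L c S stands for 2 ^ (Σ Lᵢ Xᵢ + c + Σ Sᵢ ρᵢ), where X are the large and ρ the small variables;
-- coefficients beyond the end of a list are zero. A group is the sum of its forms.
data Form : Set where
  form : (L : List ℕ) (c : ℕ) (S : List ℕ) → Form

Group : Set
Group = List Form

data Order : Set where
  before same after : Order

-- A lexicographic order that brings equal forms together. Its answers `before` and `after` say
-- nothing about the sizes of the exponents; only `same` is used in that way.
compareV : List ℕ → List ℕ → Order
compareV [] [] = same
compareV [] (_ ∷ _) = before
compareV (_ ∷ _) [] = after
compareV (x ∷ xs) (y ∷ ys) with x ≡ᵇ y
... | true = compareV xs ys
... | false with x <ᵇ y
...   | true = before
...   | false = after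

compareF : Form → Form → Order
compareF (form L c S) (form L' c' S') with compareV L L'
... | before = before
... | after = after
... | same with c ≡ᵇ c'
...   | true = compareV S S'
...   | false with c <ᵇ c'
...     | true = before
...     | false = after

bump : Form → Form
bump (form L c S) = form L (suc c) S

-- Two equal forms are a carry: 2^e + 2^e becomes 2^(e+1). The bumped form comes later in the order
-- than the one it replaces, so it is inserted into the tail, where it may carry again.
insert : Form → Group → Group
insert f [] = f ∷ []
insert f (g ∷ gs) with compareF f g
... | before = f ∷ g ∷ gs
... | same = insert (bump f) gs
... | after = g ∷ insert f gs

sort : Group → Group
sort [] = []
sort (f ∷ fs) = insert f (sort fs)

_≤V_ : List ℕ → List ℕ → Bool
[] ≤V _ = true
(_ ∷ _) ≤V [] = false
(x ∷ xs) ≤V (y ∷ ys) with y <ᵇ x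
... | true = false
... | false = xs ≤V ys

_<V_ : List ℕ → List ℕ → Bool
[] <V [] = false
[] <V (zero ∷ ys) = [] <V ys
[] <V (suc _ ∷ _) = true
(_ ∷ _) <V [] = false
(x ∷ xs) <V (y ∷ ys) with x ≡ᵇ y
... | true = xs <V ys
... | false with x <ᵇ y
...   | true = xs ≤V ys
...   | false = false

_≪_ : Form → Form → Bool
form L _ _ ≪ form L' _ _ = L <V L'

-- Small variables may be zero, so between equal large parts strictness has to come from the
-- constants.
nearBelow : Order → ℕ → List ℕ → ℕ → List ℕ → Bool
nearBelow same c S c' S' with c <ᵇ c'
... | true = S ≤V S'
... | false = false
nearBelow before _ _ _ _ = false
nearBelow after _ _ _ _ = false

below : Form → Form → Bool
below (form L c S) (form L' c' S') with L <V L'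
... | true = true
... | false = nearBelow (compareV L L') c S c' S'

conflict : Form → Group → Maybe Form
conflict f [] = nothing
conflict f (g ∷ gs) with below f g
... | true = conflict f gs
... | false = just g

chainFrom : Form → Group → ℕ
chainFrom f [] = 1
chainFrom f (g ∷ gs) with f ≪ g
... | true = suc (chainFrom g gs)
... | false = chainFrom f gs

-- The forms of a group without large variables may overlap, so only one digit is certain.
chain : Group → ℕ
chain [] = 0
chain (form [] c S ∷ fs) = 1
chain (form (a ∷ L) c S ∷ fs) = chainFrom (form (a ∷ L) c S) fs

-- Substitutions for variables and the choice of case distinctions

coeff : ℕ → List ℕ → ℕ
coeff _ [] = 0
coeff zero (a ∷ _) = a
coeff (suc i) (_ ∷ as) = coeff i as

addAt : ℕ → ℕ → List ℕ → List ℕ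
addAt zero a [] = a ∷ []
addAt zero a (b ∷ bs) = a + b ∷ bs
addAt (suc i) a [] = 0 ∷ addAt i a []
addAt (suc i) a (b ∷ bs) = b ∷ addAt i a bs

zeroAt : ℕ → List ℕ → List ℕ
zeroAt _ [] = []
zeroAt zero (_ ∷ as) = 0 ∷ as
zeroAt (suc i) (a ∷ as) = a ∷ zeroAt i as

-- smallGe x y, smallGt x y, largeGe x y and largeNear x y rewrite variable x as y + z or y + 1 + z; the new
-- variable z takes over the index x, except in largeNear, where it is small and goes to the front of S.
data Subst : Set where
  vanish shift : ℕ → Subst
  smallGe smallGt largeGe largeNear : ℕ → ℕ → Subst

moveGe moveGt : ℕ → ℕ → List ℕ → ℕ → List ℕ → Form
moveGe zero y L c S = form L c S
moveGe (suc d) y L c S = form L c (addAt y (suc d) S)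
moveGt zero y L c S = form L c S
moveGt (suc d) y L c S = form L (suc d + c) (addAt y (suc d) S)

apply : Subst → Form → Form
apply (vanish x) (form L c S) = form L c (zeroAt x S)
apply (shift x) (form L c S) = form L (coeff x S + c) S
apply (smallGe x y) (form L c S) = moveGe (coeff x S) y L c S
apply (smallGt x y) (form L c S) = moveGt (coeff x S) y L c S
apply (largeGe x y) (form L c S) = form (addAt y (coeff x L) L) c S
apply (largeNear x y) (form L c S) = form (zeroAt x (addAt y (coeff x L) L)) c (coeff x L ∷ S)

applyG : Subst → Group → Group
applyG σ [] = []
applyG σ (f ∷ fs) = apply σ f ∷ applyG σ fs

applyGs : Subst → List Group → List Group
applyGs σ [] = []
applyGs σ (g ∷ gs) = applyG σ g ∷ applyGs σ gs

excess : ℕ → List ℕ → List ℕ → Maybe ℕ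
excess i [] _ = nothing
excess i (_ ∷ _) [] = nothing
excess i (x ∷ xs) (y ∷ ys) with y <ᵇ x
... | true = just i
... | false = excess (suc i) xs ys

data Split : Set where
  onLarge onSmall : ℕ → ℕ → Split
  onZero : ℕ → Split
  stuck : Split

-- If only one form has a larger coefficient, the comparison hinges on whether that variable is
-- zero: `vanish` removes it, `shift` moves one copy of its coefficient into the constant.
splitSmall : Maybe ℕ → Maybe ℕ → Split
splitSmall (just x) (just y) = onSmall x y
splitSmall (just x) nothing = onZero x
splitSmall nothing (just y) = onZero y
splitSmall nothing nothing = stuck

split : Form → Form → Split
split (form L _ S) (form L' _ S') with excess 0 L L' | excess 0 L' L
... | just x | just y = onLarge x y
... | just _ | nothing = stuck
... | nothing | _ = splitSmall (excess 0 S S') (excess 0 S' S)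

data Choice : Set where
  none : Choice
  choice : (size : ℕ) (f g : Form) → Choice

-- Branching on the smallest group keeps the search short; groups with large variables are left for last.
cost : Group → ℕ
cost (form (_ ∷ _) _ _ ∷ gs) = 1000 + length gs
cost gs = length gs

prefer : ℕ → Form → Form → Choice → Choice
prefer w f g none = choice w f g
prefer w f g (choice w' f' g') with w <ᵇ w'
... | true = choice w f g
... | false = choice w' f' g'

-- The search

data Result : Set where
  refuted : Result
  unresolved : ℕ → Choice → List Group → Result

-- cap is the number of digits still allowed, lb a lower bound for the digits of the groups done.
reduce : ℕ → ℕ → Choice → List Group → List Group → Result
peel : ℕ → ℕ → Choice → List Group → List Group → Group → Result
reduce cap lb m done [] = unresolved cap m done
reduce cap lb m done (g ∷ gs) = peel cap lb m done gs (sort g)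
peel cap lb m done gs [] = reduce cap lb m done gs
peel cap lb m done gs (f ∷ fs) with conflict f fs
peel cap lb m done gs (f ∷ fs) | nothing with lb <ᵇ cap
... | true = peel (pred cap) lb m done gs fs
-- The finished groups alone already reach the cap, so the digit just found exceeds it.
... | false = refuted
peel cap lb m done gs (f ∷ fs) | just g with cap <ᵇ chain (f ∷ fs) + lb
... | true = refuted
... | false = reduce cap (chain (f ∷ fs) + lb) (prefer (cost (f ∷ fs)) f g m) ((f ∷ fs) ∷ done) gs

check : ℕ → ℕ → List Group → Bool
checkResult : ℕ → Result → Bool
checkSplit : ℕ → ℕ → Split → List Group → Bool
check zero _ _ = false
check (suc n) cap gs = checkResult n (reduce cap 0 none [] gs)
checkResult n refuted = true
checkResult n (unresolved cap none gs) = false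
checkResult n (unresolved cap (choice _ f g) gs) = checkSplit n cap (split f g) gs
checkSplit n cap (onZero x) gs = check n cap (applyGs (vanish x) gs) ∧ check n cap (applyGs (shift x) gs)
checkSplit n cap (onSmall x y) gs with x ≡ᵇ y
... | true = false
... | false = check n cap (applyGs (smallGe x y) gs) ∧ check n cap (applyGs (smallGt y x) gs)
checkSplit n cap (onLarge x y) gs with x ≡ᵇ y
... | true = false
... | false = check n cap (applyGs (largeGe x y) gs) ∧ check n cap (applyGs (largeGe y x) gs)
            ∧ check n cap (applyGs (largeNear x y) gs) ∧ check n cap (applyGs (largeNear y x) gs)
checkSplit n cap stuck gs = false

-- The symbolic square and its division into groups

zeros : List Bool → List ℕ
zeros = map (λ _ → 0)

-- A gap counts the zeros between two consecutive ones, so it moves all later ones up by its value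
-- plus one. Every gap has a place in both lists; the coefficient in the list of the other kind is
-- 0.
prepend : Bool → Form → Form
prepend true (form L c S) = form (1 ∷ L) (suc c) (0 ∷ S)
prepend false (form L c S) = form (0 ∷ L) (suc c) (1 ∷ S)

bits : List Bool → Group
bits [] = form [] 0 [] ∷ []
bits (b ∷ κ) = form (zeros (b ∷ κ)) 0 (zeros (b ∷ κ)) ∷ map (prepend b) (bits κ)

_⊕_ : List ℕ → List ℕ → List ℕ
[] ⊕ ys = ys
(x ∷ xs) ⊕ [] = x ∷ xs
(x ∷ xs) ⊕ (y ∷ ys) = x + y ∷ xs ⊕ ys

_⊞_ : Form → Form → Form
form L c S ⊞ form L' c' S' = form (L ⊕ L') (c + c') (S ⊕ S')

square : Group → Group
square [] = []
square (f ∷ fs) = f ⊞ f ∷ map (λ g → bump (f ⊞ g)) fs ++ square fs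

-- Forms with large part u lose it, since a common power of two does not affect the digit sum.
partition : List ℕ → Group → Group × Group
partition u [] = [] , []
partition u (form L c S ∷ fs) with compareV L u | partition u fs
... | same | es , os = form [] c S ∷ es , os
... | before | es , os = es , form L c S ∷ os
... | after | es , os = es , form L c S ∷ os

allAbove allBelow : List ℕ → Group → Bool
allAbove u [] = true
allAbove u (form L _ _ ∷ fs) = (u <V L) ∧ allAbove u fs
allBelow u [] = true
allBelow u (form L _ _ ∷ fs) = (L <V u) ∧ allBelow u fs

-- The forms at `u` can be split off without a carry if all other forms lie far above them, or all
-- far below.
detach : List ℕ → Group → Group × Group
detach u g with partition u g
... | es , os with allAbove u os
...   | true = es , os
...   | false with allBelow u os
...     | true = es , os
-- The empty group has digit sum 0, so a failed attempt costs nothing.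
...     | false = [] , g

detachAll : List (List ℕ) → Group → List Group
detachAll [] g = g ∷ []
detachAll (u ∷ us) g = proj₁ (detach u g) ∷ detachAll us (proj₂ (detach u g))

laterParts : List ℕ → Group → List (List ℕ)
laterParts u [] = []
laterParts u (form L _ _ ∷ fs) with compareV u L
... | same = laterParts u fs
... | before = L ∷ laterParts L fs
... | after = L ∷ laterParts L fs

-- Ones separated only by small gaps share their large part, so for `bits κ` there is one entry for
-- each cluster.
largeParts : Group → List (List ℕ)
largeParts [] = []
largeParts (form L _ _ ∷ fs) = L ∷ laterParts L fs

lastTwo : List (List ℕ) → List (List ℕ)
lastTwo [] = []
lastTwo (u ∷ []) = []
lastTwo (u ∷ v ∷ []) = v ⊕ v ∷ u ⊕ v ∷ []
lastTwo (u ∷ v ∷ w ∷ us) = lastTwo (v ∷ w ∷ us)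

-- If the large gaps cut n into clusters a₀, …, aᵣ, the pivots belong to a₀², 2a₀a₁, aᵣ² and 2aᵣ₋₁aᵣ, which lie
-- apart from everything else in n².
pivots : List (List ℕ) → List (List ℕ)
pivots (u ∷ v ∷ us) = u ⊕ u ∷ u ⊕ v ∷ lastTwo (u ∷ v ∷ us)
pivots us = []

-- A long enough chain of far apart exponents in the square settles a pattern without a search. The
-- number 200 bounds the depth of nested case distinctions.
verify : ℕ → List Bool → Bool
verify k κ with k <ᵇ chain (square (bits κ))
... | true = true
... | false = check 200 k (detachAll (pivots (largeParts (bits κ))) (square (bits κ)))

-- Soundness of sorting and of comparisons

Env : Set
Env = ℕ → ℕ

dot : List ℕ → Env → ℕ
dot [] v = 0
dot (a ∷ as) v = a * v 0 + dot as (v ∘ suc)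

exponent : Env → Env → Form → ℕ
exponent X ρ (form L c S) = dot L X + (c + dot S ρ)

value : Env → Env → Group → ℕ
value X ρ [] = 0
value X ρ (f ∷ fs) = 2 ^ exponent X ρ f + value X ρ fs

digits : Env → Env → List Group → ℕ
digits X ρ [] = 0
digits X ρ (g ∷ gs) = s (value X ρ g) + digits X ρ gs

-- P holds once the large variables are large enough, depending on a strict bound T for the small ones.
Ev : (Env → Env → Set) → Set
Ev P = ∀ T → ∃[ G ] (∀ X ρ → (∀ i → ρ i < T) → (∀ i → G ≤ X i) → P X ρ)

always : ∀ {P} → (∀ X ρ → P X ρ) → Ev P
always p T = 0 , λ X ρ _ _ → p X ρ

ev-map : ∀ {P Q : Env → Env → Set} → (∀ {X ρ} → P X ρ → Q X ρ) → Ev P → Ev Q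
ev-map f p T = proj₁ (p T) , λ X ρ ρ< X≥ → f (proj₂ (p T) X ρ ρ< X≥)

ev-map₂ : ∀ {P Q R : Env → Env → Set} → (∀ {X ρ} → P X ρ → Q X ρ → R X ρ) → Ev P → Ev Q → Ev R
ev-map₂ f p q T = proj₁ (p T) ⊔ proj₁ (q T) , λ X ρ ρ< X≥ →
  f (proj₂ (p T) X ρ ρ< (λ i → ≤-trans (m≤m⊔n _ _) (X≥ i)))
    (proj₂ (q T) X ρ ρ< (λ i → ≤-trans (m≤n⊔m (proj₁ (p T)) _) (X≥ i)))

≡ᵇ-true : ∀ m n → (m ≡ᵇ n) ≡ true → m ≡ n
≡ᵇ-true m n eq = ≡ᵇ⇒≡ m n (subst T (sym eq) tt)

<ᵇ-true : ∀ m n → (m <ᵇ n) ≡ true → m < n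
<ᵇ-true m n eq = <ᵇ⇒< m n (subst T (sym eq) tt)

<ᵇ-false : ∀ m n → (m <ᵇ n) ≡ false → n ≤ m
<ᵇ-false m n eq with m <? n
... | no m≮n = ≮⇒≥ m≮n
... | yes m<n = ⊥-elim (subst T eq (<⇒<ᵇ m<n))

compareV-same : ∀ xs ys → compareV xs ys ≡ same → xs ≡ ys
compareV-same [] [] _ = refl
compareV-same (x ∷ xs) (y ∷ ys) eq with x ≡ᵇ y in x≡y
... | true = cong₂ _∷_ (≡ᵇ-true x y x≡y) (compareV-same xs ys eq)
... | false with x <ᵇ y
compareV-same (x ∷ xs) (y ∷ ys) () | false | true
compareV-same (x ∷ xs) (y ∷ ys) () | false | false

compareF-same : ∀ f g → compareF f g ≡ same → f ≡ g
compareF-same (form L c S) (form L' c' S') eq with compareV L L' in L≡L'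
... | same with c ≡ᵇ c' in c≡c'
...   | true rewrite compareV-same L L' L≡L' | ≡ᵇ-true c c' c≡c' = cong (form L' c') (compareV-same S S' eq)
compareF-same (form L c S) (form L' c' S') eq | same | false with c <ᵇ c'
compareF-same (form L c S) (form L' c' S') () | same | false | true
compareF-same (form L c S) (form L' c' S') () | same | false | false

exponent-bump : ∀ X ρ f → exponent X ρ (bump f) ≡ suc (exponent X ρ f)
exponent-bump X ρ (form L c S) = +-suc (dot L X) _

merge-powers : ∀ e v → 2 ^ suc e + v ≡ 2 ^ e + (2 ^ e + v)
merge-powers e v = trans (cong (λ t → 2 ^ e + t + v) (+-identityʳ _)) (+-assoc (2 ^ e) _ v)

exchange : ∀ a b c → b + (a + c) ≡ a + (b + c)
exchange = solve-∀

value-insert : ∀ X ρ f g → value X ρ (insert f g) ≡ 2 ^ exponent X ρ f + value X ρ g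
value-insert X ρ f [] = refl
value-insert X ρ f (g ∷ gs) with compareF f g in eq
... | before = refl
... | after = trans (cong (2 ^ exponent X ρ g +_) (value-insert X ρ f gs)) (exchange (2 ^ exponent X ρ f) _ (value X ρ gs))
... | same rewrite compareF-same f g eq =
  trans (value-insert X ρ (bump g) gs)
    (trans (cong (λ e → 2 ^ e + value X ρ gs) (exponent-bump X ρ g)) (merge-powers (exponent X ρ g) _))

value-sort : ∀ X ρ g → value X ρ (sort g) ≡ value X ρ g
value-sort X ρ [] = refl
value-sort X ρ (f ∷ fs) = trans (value-insert X ρ f (sort fs)) (cong (2 ^ exponent X ρ f +_) (value-sort X ρ fs))

≤V-sound : ∀ xs ys v → (xs ≤V ys) ≡ true → dot xs v ≤ dot ys v
≤V-sound [] ys v _ = z≤n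
≤V-sound (x ∷ xs) (y ∷ ys) v eq with y <ᵇ x in y<x
... | false = +-mono-≤ (*-monoˡ-≤ (v 0) (<ᵇ-false y x y<x)) (≤V-sound xs ys (v ∘ suc) eq)

-- No coefficient decreases and at least one increases, so the difference contains a whole variable,
-- which is at least `G`. This turns large gaps into distance between exponents.
<V-sound : ∀ xs ys v G → (∀ i → G ≤ v i) → (xs <V ys) ≡ true → dot xs v + G ≤ dot ys v
<V-sound [] (zero ∷ ys) v G v≥ eq = <V-sound [] ys (v ∘ suc) G (v≥ ∘ suc) eq
<V-sound [] (suc y ∷ ys) v G v≥ eq = ≤-trans (v≥ 0) (≤-trans (m≤m+n (v 0) _) (m≤m+n _ _))
<V-sound (x ∷ xs) (y ∷ ys) v G v≥ eq with x ≡ᵇ y in x≡y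
... | true rewrite ≡ᵇ-true x y x≡y = ≤-trans (≤-reflexive (+-assoc (y * v 0) _ G))
        (+-monoʳ-≤ (y * v 0) (<V-sound xs ys (v ∘ suc) G (v≥ ∘ suc) eq))
... | false with x <ᵇ y in x<y
...   | true = begin
  x * v 0 + dot xs (v ∘ suc) + G     ≡⟨ rearrange (x * v 0) _ G ⟩
  G + x * v 0 + dot xs (v ∘ suc)     ≤⟨ +-mono-≤ (+-monoˡ-≤ (x * v 0) (v≥ 0)) (≤V-sound xs ys (v ∘ suc) eq) ⟩
  suc x * v 0 + dot ys (v ∘ suc)     ≤⟨ +-monoˡ-≤ _ (*-monoˡ-≤ (v 0) (<ᵇ-true x y x<y)) ⟩
  y * v 0 + dot ys (v ∘ suc)         ∎
  where
  open ≤-Reasoning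
  rearrange : ∀ a b c → a + b + c ≡ c + a + b
  rearrange = solve-∀

dot-mono : ∀ as {v w : Env} → (∀ i → v i ≤ w i) → dot as v ≤ dot as w
dot-mono [] v≤w = z≤n
dot-mono (a ∷ as) v≤w = +-mono-≤ (*-monoʳ-≤ a (v≤w 0)) (dot-mono as (v≤w ∘ suc))

smallMax : ℕ → Form → ℕ
smallMax T (form L c S) = c + dot S (λ _ → T)

-- The variable gained in the large part pays for the constant and the small variables of `f` and
-- for the additional distance `D`.
≪-sound : ∀ f g T G D X ρ → (f ≪ g) ≡ true → (∀ i → ρ i < T) → smallMax T f + D ≤ G → (∀ i → G ≤ X i) →
  exponent X ρ f + D ≤ exponent X ρ g
≪-sound (form L c S) (form L' c' S') T G D X ρ f≪g ρ< le X≥ = begin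
  dot L X + (c + dot S ρ) + D    ≡⟨ +-assoc (dot L X) _ D ⟩
  dot L X + ((c + dot S ρ) + D)  ≤⟨ +-monoʳ-≤ (dot L X) (≤-trans (+-monoˡ-≤ D (+-monoʳ-≤ c (dot-mono S (λ i → <⇒≤ (ρ< i))))) le) ⟩
  dot L X + G                    ≤⟨ <V-sound L L' X G X≥ f≪g ⟩
  dot L' X                       ≤⟨ m≤m+n _ _ ⟩
  dot L' X + (c' + dot S' ρ)     ∎
  where open ≤-Reasoning

below-sound : ∀ f g → below f g ≡ true → Ev (λ X ρ → exponent X ρ f < exponent X ρ g)
below-sound f@(form L c S) g@(form L' c' S') eq with L <V L' in far
... | true = λ T → smallMax T f + 1 , λ X ρ ρ< X≥ →
  subst (_≤ exponent X ρ g) (+-comm _ 1) (≪-sound f g T _ 1 X ρ far ρ< ≤-refl X≥)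
... | false with compareV L L' in L≡L'
...   | same with c <ᵇ c' in c<c'
...     | true rewrite compareV-same L L' L≡L' = always λ X ρ →
  +-monoʳ-< (dot L' X) (+-mono-<-≤ (<ᵇ-true c c' c<c') (≤V-sound S S' ρ eq))

conflict-nothing : ∀ f fs → conflict f fs ≡ nothing → Ev (λ X ρ → All (λ g → exponent X ρ f < exponent X ρ g) fs)
conflict-nothing f [] _ = always λ _ _ → []
conflict-nothing f (g ∷ gs) eq with below f g in f<g
... | true = ev-map₂ _∷_ (below-sound f g f<g) (conflict-nothing f gs eq)

multiple : ∀ e X ρ fs → All (λ g → e ≤ exponent X ρ g) fs → ∃[ m ] value X ρ fs ≡ 2 ^ e * m
multiple e X ρ [] [] = 0 , sym (*-zeroʳ (2 ^ e))
multiple e X ρ (f ∷ fs) (e≤f ∷ rest) with multiple e X ρ fs rest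
... | m , eq = 2 ^ (exponent X ρ f ∸ e) + m , (begin
  2 ^ exponent X ρ f + value X ρ fs                ≡⟨ cong₂ _+_ (cong (2 ^_) (sym (m+[n∸m]≡n e≤f))) eq ⟩
  2 ^ (e + (exponent X ρ f ∸ e)) + 2 ^ e * m       ≡⟨ cong (_+ 2 ^ e * m) (^-distribˡ-+-* 2 e _) ⟩
  2 ^ e * 2 ^ (exponent X ρ f ∸ e) + 2 ^ e * m     ≡⟨ *-distribˡ-+ (2 ^ e) _ m ⟨
  2 ^ e * (2 ^ (exponent X ρ f ∸ e) + m)           ∎)
  where open ≡-Reasoning

s-power : ∀ e → s (2 ^ e) ≡ 1
s-power e = trans (cong s (sym (*-identityʳ (2 ^ e)))) (s-shift e 1)

-- The remaining forms add up to a multiple of 2^(e+1), so they leave position e, the exponent of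
-- `f`, untouched.
s-peel : ∀ X ρ f fs → All (λ g → exponent X ρ f < exponent X ρ g) fs →
  s (value X ρ (f ∷ fs)) ≡ suc (s (value X ρ fs))
s-peel X ρ f fs f< with multiple (suc (exponent X ρ f)) X ρ fs f<
... | m , eq = begin
  s (2 ^ e + value X ρ fs)     ≡⟨ cong (λ v → s (2 ^ e + v)) eq ⟩
  s (2 ^ e + 2 ^ suc e * m)    ≡⟨ s-split (suc e) (2 ^ e) m (^-monoʳ-< 2 (s≤s (s≤s z≤n)) (n<1+n e)) ⟩
  s (2 ^ e) + s m              ≡⟨ cong₂ _+_ (s-power e) (sym (s-shift (suc e) m)) ⟩
  1 + s (2 ^ suc e * m)        ≡⟨ cong (λ v → suc (s v)) eq ⟨
  suc (s (value X ρ fs))       ∎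
  where
  open ≡-Reasoning
  e = exponent X ρ f

-- Digits contributed by a chain of exponents

powers : List ℕ → ℕ
powers [] = 0
powers (e ∷ es) = 2 ^ e + powers es

Clear : ℕ → ℕ → ℕ → Set
Clear H w e = e + H ≤ w ⊎ w ≤ e

-- If e lies in the window below the point found for es, restarting from that point leaves e below the new window.
clear-point : ∀ H es w₀ → ∃[ w ] (w₀ + H ≤ w × w ≤ w₀ + H * 2 ^ length es × All (Clear H w) es)
clear-point H [] w₀ = w₀ + H , ≤-refl , ≤-reflexive (cong (w₀ +_) (sym (*-identityʳ H))) , []
clear-point H (e ∷ es) w₀ with clear-point H es w₀
... | w , lo , hi , ok with e + H ≤? w | w ≤? e
...   | yes p | _ = w , lo , ≤-trans hi (+-monoʳ-≤ w₀ (*-monoʳ-≤ H (m≤m+n (2 ^ length es) _))) , inj₁ p ∷ ok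
...   | no _ | yes p = w , lo , ≤-trans hi (+-monoʳ-≤ w₀ (*-monoʳ-≤ H (m≤m+n (2 ^ length es) _))) , inj₂ p ∷ ok
...   | no _ | no w≰e with clear-point H es w
...     | w' , lo' , hi' , ok' =
  w' , ≤-trans lo (m+n≤o⇒m≤o w lo') , upper , inj₁ (≤-trans (+-monoˡ-≤ H (≰⇒≥ w≰e)) lo') ∷ ok'
  where
  open ≤-Reasoning
  double : ∀ a h p → a + h * p + h * p ≡ a + h * (2 * p)
  double = solve-∀
  upper : w' ≤ w₀ + H * 2 ^ suc (length es)
  upper = begin
    w'                                          ≤⟨ hi' ⟩
    w + H * 2 ^ length es                       ≤⟨ +-monoˡ-≤ _ hi ⟩
    w₀ + H * 2 ^ length es + H * 2 ^ length es  ≡⟨ double w₀ H (2 ^ length es) ⟩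
    w₀ + H * 2 ^ suc (length es)                ∎

upper : ℕ → List ℕ → List ℕ
upper w [] = []
upper w (e ∷ es) with w ≤? e
... | yes _ = e ∷ upper w es
... | no _ = upper w es

lower-sum : ℕ → List ℕ → ℕ
lower-sum w [] = 0
lower-sum w (e ∷ es) with w ≤? e
... | yes _ = lower-sum w es
... | no _ = 2 ^ e + lower-sum w es

powers-cut : ∀ w es → powers es ≡ lower-sum w es + powers (upper w es)
powers-cut w [] = refl
powers-cut w (e ∷ es) with w ≤? e
... | yes _ = trans (cong (2 ^ e +_) (powers-cut w es)) (exchange (lower-sum w es) (2 ^ e) _)
... | no _ = trans (cong (2 ^ e +_) (powers-cut w es)) (sym (+-assoc (2 ^ e) _ _))

length-upper : ∀ w es → length (upper w es) ≤ length es
length-upper w [] = z≤n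
length-upper w (e ∷ es) with w ≤? e
... | yes _ = s≤s (length-upper w es)
... | no _ = m≤n⇒m≤1+n (length-upper w es)

∈-upper : ∀ {v} w es → v ∈ es → w ≤ v → v ∈ upper w es
∈-upper w (e ∷ es) v∈ w≤v with w ≤? e | v∈
... | yes _ | here refl = here refl
... | yes _ | there v∈es = there (∈-upper w es v∈es w≤v)
... | no w≰e | here refl = ⊥-elim (w≰e w≤v)
... | no _ | there v∈es = ∈-upper w es v∈es w≤v

lower-sum-positive : ∀ {v} w es → v ∈ es → v < w → 0 < lower-sum w es
lower-sum-positive w (e ∷ es) v∈ v<w with w ≤? e | v∈
... | yes w≤e | here refl = ⊥-elim (<⇒≱ v<w w≤e)
... | yes _ | there v∈es = lower-sum-positive w es v∈es v<w
... | no _ | _ = ≤-trans (m^n>0 2 e) (m≤m+n _ _)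

-- Each power below the window is at most 2^(w-H). Multiplying by 2^H avoids the subtraction.
lower-sum-small : ∀ H w es → All (Clear H w) es → lower-sum w es * 2 ^ H ≤ length es * 2 ^ w
lower-sum-small H w [] [] = z≤n
lower-sum-small H w (e ∷ es) (c ∷ cs) with w ≤? e | c
... | yes _ | _ = ≤-trans (lower-sum-small H w es cs) (m≤n+m _ (2 ^ w))
... | no _ | inj₁ e+H≤w = begin
  (2 ^ e + lower-sum w es) * 2 ^ H          ≡⟨ *-distribʳ-+ (2 ^ H) (2 ^ e) _ ⟩
  2 ^ e * 2 ^ H + lower-sum w es * 2 ^ H    ≡⟨ cong (_+ lower-sum w es * 2 ^ H) (^-distribˡ-+-* 2 e H) ⟨
  2 ^ (e + H) + lower-sum w es * 2 ^ H      ≤⟨ +-mono-≤ (^-monoʳ-≤ 2 e+H≤w) (lower-sum-small H w es cs) ⟩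
  2 ^ w + length es * 2 ^ w                 ∎
  where open ≤-Reasoning
... | no w≰e | inj₂ w≤e = ⊥-elim (w≰e w≤e)

upper-multiple : ∀ w es → ∃[ m ] powers (upper w es) ≡ 2 ^ w * m
upper-multiple w [] = 0 , sym (*-zeroʳ (2 ^ w))
upper-multiple w (e ∷ es) with w ≤? e
... | no _ = upper-multiple w es
... | yes w≤e with upper-multiple w es
...   | m , eq = 2 ^ (e ∸ w) + m , (begin
  2 ^ e + powers (upper w es)            ≡⟨ cong₂ _+_ (cong (2 ^_) (sym (m+[n∸m]≡n w≤e))) eq ⟩
  2 ^ (w + (e ∸ w)) + 2 ^ w * m          ≡⟨ cong (_+ 2 ^ w * m) (^-distribˡ-+-* 2 w _) ⟩
  2 ^ w * 2 ^ (e ∸ w) + 2 ^ w * m        ≡⟨ *-distribˡ-+ (2 ^ w) _ m ⟨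
  2 ^ w * (2 ^ (e ∸ w) + m)              ∎)
  where open ≡-Reasoning

data Chain (D : ℕ) (es : List ℕ) : ℕ → ℕ → Set where
  end  : ∀ {v} → v ∈ es → Chain D es v 1
  step : ∀ {v v' n} → v ∈ es → v + D ≤ v' → Chain D es v' n → Chain D es v (suc n)

chain-upper : ∀ {D es v n} w → Chain D es v n → w ≤ v → Chain D (upper w es) v n
chain-upper w (end v∈) w≤v = end (∈-upper w _ v∈ w≤v)
chain-upper w (step v∈ v≤v' ch) w≤v =
  step (∈-upper w _ v∈ w≤v) v≤v' (chain-upper w ch (≤-trans w≤v (m+n≤o⇒m≤o _ v≤v')))

powers-positive : ∀ {v} es → v ∈ es → 0 < powers es
powers-positive (e ∷ es) _ = ≤-trans (m^n>0 2 e) (m≤m+n _ _)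

-- Among at most H exponents there is, between any two consecutive chain elements, a window of H unused
-- positions; no carry crosses it, so every chain element contributes a digit of its own.
chain-digits : ∀ H es v n → length es ≤ H → Chain (H * 2 ^ H) es v n → n ≤ s (powers es)
chain-digits H es v _ _ (end v∈) = s>0 (powers es) (powers-positive es v∈)
chain-digits zero (e ∷ es) v _ () (step v∈ _ _)
chain-digits H@(suc _) es v (suc n) len (step {v' = v'} v∈ v≤v' ch) with clear-point H es v
... | w , lo , hi , clear with upper-multiple w es
...   | m , up≡ = begin
  1 + n                                    ≤⟨ +-mono-≤ (s>0 l (lower-sum-positive w es v∈ v<w)) (chain-digits H (upper w es) v' n (≤-trans (length-upper w es) len) (chain-upper w ch w≤v')) ⟩
  s l + s (powers (upper w es))            ≡⟨ cong (λ t → s l + s t) up≡ ⟩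
  s l + s (2 ^ w * m)                      ≡⟨ cong (s l +_) (s-shift w m) ⟩
  s l + s m                                ≡⟨ s-split w l m l<2ʷ ⟨
  s (l + 2 ^ w * m)                        ≡⟨ cong (λ t → s (l + t)) up≡ ⟨
  s (l + powers (upper w es))              ≡⟨ cong s (powers-cut w es) ⟨
  s (powers es)                            ∎
  where
  open ≤-Reasoning
  l = lower-sum w es
  v<w : v < w
  v<w = ≤-trans (m<m+n v (s≤s z≤n)) lo
  w≤v' : w ≤ v'
  -- The clear point is found within H * 2^H of `v`, which is the distance between chain elements.
  w≤v' = ≤-trans hi (≤-trans (+-monoʳ-≤ v (*-monoʳ-≤ H (^-monoʳ-≤ 2 len))) v≤v')
  l<2ʷ : l < 2 ^ w
  -- At most H powers lie below the window, and H < 2^H, so their sum does not reach 2^w.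
  l<2ʷ = *-cancelʳ-< (2 ^ H) l (2 ^ w) (begin-strict
    l * 2 ^ H            ≤⟨ lower-sum-small H w es clear ⟩
    length es * 2 ^ w    ≤⟨ *-monoˡ-≤ (2 ^ w) len ⟩
    H * 2 ^ w            <⟨ *-monoˡ-< (2 ^ w) {{m^n≢0 2 w}} (n<2^n H) ⟩
    2 ^ H * 2 ^ w        ≡⟨ *-comm (2 ^ H) (2 ^ w) ⟩
    2 ^ w * 2 ^ H        ∎)

value-powers : ∀ X ρ g → value X ρ g ≡ powers (map (exponent X ρ) g)
value-powers X ρ [] = refl
value-powers X ρ (f ∷ fs) = cong (2 ^ exponent X ρ f +_) (value-powers X ρ fs)

totalMax : ℕ → Group → ℕ
totalMax T [] = 0
totalMax T (f ∷ fs) = smallMax T f + totalMax T fs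

smallMax≤totalMax : ∀ T {f} g → f ∈ g → smallMax T f ≤ totalMax T g
smallMax≤totalMax T (f ∷ fs) (here refl) = m≤m+n _ _
smallMax≤totalMax T (f ∷ fs) (there f∈) = ≤-trans (smallMax≤totalMax T fs f∈) (m≤n+m _ (smallMax T f))

chainFrom-sound : ∀ g T D G X ρ → (∀ i → ρ i < T) → totalMax T g + D ≤ G → (∀ i → G ≤ X i) →
  ∀ f fs → f ∈ g → (∀ {h} → h ∈ fs → h ∈ g) → Chain D (map (exponent X ρ) g) (exponent X ρ f) (chainFrom f fs)
chainFrom-sound g T D G X ρ ρ< le X≥ f [] f∈ fs⊆ = end (∈-map⁺ (exponent X ρ) f∈)
chainFrom-sound g T D G X ρ ρ< le X≥ f (h ∷ hs) f∈ fs⊆ with f ≪ h in f≪h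
... | false = chainFrom-sound g T D G X ρ ρ< le X≥ f hs f∈ (λ h∈ → fs⊆ (there h∈))
... | true = step (∈-map⁺ (exponent X ρ) f∈)
  (≪-sound f h T G D X ρ f≪h ρ< (≤-trans (+-monoˡ-≤ D (smallMax≤totalMax T g f∈)) le) X≥)
  (chainFrom-sound g T D G X ρ ρ< le X≥ h hs (fs⊆ (here refl)) (λ h∈ → fs⊆ (there h∈)))

chain-sound : ∀ g → Ev (λ X ρ → chain g ≤ s (value X ρ g))
chain-sound [] = always λ _ _ → z≤n
chain-sound (f@(form [] c S) ∷ fs) = always λ X ρ → s>0 _ (≤-trans (m^n>0 2 (exponent X ρ f)) (m≤m+n _ _))
-- `totalMax` absorbs the constants and small parts of all forms at once; `D` is the distance that
-- `chain-digits` asks for.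
chain-sound g@(f@(form (_ ∷ _) _ _) ∷ fs) T = totalMax T g + D , λ X ρ ρ< X≥ →
  subst (λ v → chainFrom f fs ≤ s v) (sym (value-powers X ρ g))
    (chain-digits H (map (exponent X ρ) g) _ _ (≤-reflexive (length-map (exponent X ρ) g))
      (chainFrom-sound g T D _ X ρ ρ< ≤-refl X≥ f fs (here refl) there))
  where
  H = length g
  D = H * 2 ^ H

-- Soundness of the search

Exceeds : ℕ → List Group → Set
Exceeds cap gs = Ev (λ X ρ → cap < digits X ρ gs)

-- An unresolved result only reduces `P` to a claim about the groups left over and the digits still
-- allowed; that claim is then supplied by case distinction.
Establishes : Result → (Env → Env → Set) → Set
Establishes refuted P = Ev P
Establishes (unresolved cap _ gs) P = Exceeds cap gs → Ev P

establishes-map : ∀ r {P Q} → (Ev P → Ev Q) → Establishes r P → Establishes r Q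
establishes-map refuted f p = f p
establishes-map (unresolved _ _ _) f p = f ∘ p

reduce-sound : ∀ cap lb m done gs → Ev (λ X ρ → lb ≤ digits X ρ done) →
  Establishes (reduce cap lb m done gs) (λ X ρ → cap < digits X ρ done + digits X ρ gs)
peel-sound : ∀ cap lb m done gs g → Ev (λ X ρ → lb ≤ digits X ρ done) →
  Establishes (peel cap lb m done gs g) (λ X ρ → cap < digits X ρ done + (s (value X ρ g) + digits X ρ gs))
reduce-sound cap lb m done [] _ = ev-map λ {X} {ρ} → subst (cap <_) (sym (+-identityʳ (digits X ρ done)))
reduce-sound cap lb m done (g ∷ gs) lb≤ = establishes-map (peel cap lb m done gs (sort g))
  (ev-map λ {X} {ρ} → subst (λ v → cap < digits X ρ done + (s v + digits X ρ gs)) (value-sort X ρ g))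
  (peel-sound cap lb m done gs (sort g) lb≤)
peel-sound cap lb m done gs [] lb≤ = reduce-sound cap lb m done gs lb≤
peel-sound cap lb m done gs (f ∷ fs) lb≤ with conflict f fs in noConflict
peel-sound cap lb m done gs (f ∷ fs) lb≤ | nothing with lb <ᵇ cap in lb<cap
... | true = establishes-map (peel (pred cap) lb m done gs fs)
  (λ ih → ev-map₂ (λ {X} {ρ} f< lt → begin-strict
      cap                                                        ≡⟨ suc-pred cap {{>-nonZero (≤-<-trans z≤n (<ᵇ-true lb cap lb<cap))}} ⟨
      suc (pred cap)                                             <⟨ s≤s lt ⟩
      suc (digits X ρ done + (s (value X ρ fs) + digits X ρ gs))  ≡⟨ +-suc (digits X ρ done) _ ⟨
      digits X ρ done + suc (s (value X ρ fs) + digits X ρ gs)    ≡⟨ cong (λ t → digits X ρ done + (t + digits X ρ gs)) (s-peel X ρ f fs f<) ⟨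
      digits X ρ done + (s (value X ρ (f ∷ fs)) + digits X ρ gs)  ∎)
    (conflict-nothing f fs noConflict) ih)
  (peel-sound (pred cap) lb m done gs fs lb≤)
  where open ≤-Reasoning
... | false = ev-map (λ {X} {ρ} lb≤done → begin-strict
      cap                                                        ≤⟨ ≤-trans (<ᵇ-false lb cap lb<cap) lb≤done ⟩
      digits X ρ done                                             <⟨ m<m+n _ (≤-trans (s>0 _ (≤-trans (m^n>0 2 (exponent X ρ f)) (m≤m+n _ _))) (m≤m+n _ _)) ⟩
      digits X ρ done + (s (value X ρ (f ∷ fs)) + digits X ρ gs)  ∎) lb≤
  where open ≤-Reasoning
peel-sound cap lb m done gs (f ∷ fs) lb≤ | just g with cap <ᵇ chain (f ∷ fs) + lb in cap<
... | true = ev-map₂ (λ {X} {ρ} ch≤ lb≤done → begin-strict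
      cap                                                        <⟨ <ᵇ-true cap _ cap< ⟩
      chain (f ∷ fs) + lb                                        ≤⟨ +-mono-≤ ch≤ lb≤done ⟩
      s (value X ρ (f ∷ fs)) + digits X ρ done                    ≡⟨ +-comm _ (digits X ρ done) ⟩
      digits X ρ done + s (value X ρ (f ∷ fs))                    ≤⟨ +-monoʳ-≤ (digits X ρ done) (m≤m+n _ _) ⟩
      digits X ρ done + (s (value X ρ (f ∷ fs)) + digits X ρ gs)  ∎) (chain-sound (f ∷ fs)) lb≤
  where open ≤-Reasoning
... | false = establishes-map (reduce cap (chain (f ∷ fs) + lb) _ ((f ∷ fs) ∷ done) gs)
  (ev-map λ {X} {ρ} → subst (cap <_) (rearrange (digits X ρ done) _ (digits X ρ gs)))
  (reduce-sound cap _ _ ((f ∷ fs) ∷ done) gs (ev-map₂ +-mono-≤ (chain-sound (f ∷ fs)) lb≤))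
  where
  rearrange : ∀ a b c → b + a + c ≡ a + (b + c)
  rearrange = solve-∀

-- Substitutions preserve all exponents

infix 8 _[_≔_]
_[_≔_] : Env → ℕ → ℕ → Env
(v [ zero ≔ a ]) zero = a
(v [ zero ≔ a ]) (suc i) = v (suc i)
(v [ suc x ≔ a ]) zero = v zero
(v [ suc x ≔ a ]) (suc i) = ((v ∘ suc) [ x ≔ a ]) i

updated : ∀ v x a → (v [ x ≔ a ]) x ≡ a
updated v zero a = refl
updated v (suc x) a = updated (v ∘ suc) x a

not-updated : ∀ v x y a → (x ≡ᵇ y) ≡ false → (v [ x ≔ a ]) y ≡ v y
not-updated v zero (suc y) a _ = refl
not-updated v (suc x) zero a _ = refl
not-updated v (suc x) (suc y) a x≢y = not-updated (v ∘ suc) x y a x≢y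

update-all : ∀ {P : ℕ → Set} v x a → (∀ i → P (v i)) → P a → ∀ i → P ((v [ x ≔ a ]) i)
update-all v zero a p pa zero = pa
update-all v zero a p pa (suc i) = p (suc i)
update-all v (suc x) a p pa zero = p zero
update-all v (suc x) a p pa (suc i) = update-all (v ∘ suc) x a (p ∘ suc) pa i

infixr 5 _◂_
_◂_ : ℕ → Env → Env
(a ◂ v) zero = a
(a ◂ v) (suc i) = v i

dot-update : ∀ as v x a → dot as (v [ x ≔ a ]) + coeff x as * v x ≡ dot as v + coeff x as * a
dot-update [] v x a = refl
dot-update (b ∷ bs) v zero a = swap (b * a) _ (b * v 0)
  where
  swap : ∀ p q r → p + q + r ≡ r + q + p
  swap = solve-∀
dot-update (b ∷ bs) v (suc x) a = begin
  b * v 0 + dot bs ((v ∘ suc) [ x ≔ a ]) + coeff x bs * v (suc x)    ≡⟨ +-assoc (b * v 0) _ _ ⟩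
  b * v 0 + (dot bs ((v ∘ suc) [ x ≔ a ]) + coeff x bs * v (suc x))  ≡⟨ cong (b * v 0 +_) (dot-update bs (v ∘ suc) x a) ⟩
  b * v 0 + (dot bs (v ∘ suc) + coeff x bs * a)                      ≡⟨ +-assoc (b * v 0) _ _ ⟨
  b * v 0 + dot bs (v ∘ suc) + coeff x bs * a                        ∎
  where open ≡-Reasoning

dot-addAt : ∀ as v y a → dot (addAt y a as) v ≡ dot as v + a * v y
dot-addAt [] v zero a = +-identityʳ (a * v 0)
dot-addAt [] v (suc y) a = dot-addAt [] (v ∘ suc) y a
dot-addAt (b ∷ bs) v zero a = ring a b (v 0) (dot bs (v ∘ suc))
  where
  ring : ∀ a b t r → (a + b) * t + r ≡ b * t + r + a * t
  ring = solve-∀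
dot-addAt (b ∷ bs) v (suc y) a = trans (cong (b * v 0 +_) (dot-addAt bs (v ∘ suc) y a)) (sym (+-assoc (b * v 0) _ _))

dot-zeroAt : ∀ as v x → dot (zeroAt x as) v + coeff x as * v x ≡ dot as v
dot-zeroAt [] v x = refl
dot-zeroAt (b ∷ bs) v zero = +-comm (dot bs (v ∘ suc)) (b * v 0)
dot-zeroAt (b ∷ bs) v (suc x) = trans (+-assoc (b * v 0) _ _) (cong (b * v 0 +_) (dot-zeroAt bs (v ∘ suc) x))

coeff-addAt : ∀ as x y a → (x ≡ᵇ y) ≡ false → coeff x (addAt y a as) ≡ coeff x as
coeff-addAt [] zero (suc y) a _ = refl
coeff-addAt [] (suc x) zero a _ = refl
coeff-addAt [] (suc x) (suc y) a x≢y = coeff-addAt [] x y a x≢y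
coeff-addAt (b ∷ bs) zero (suc y) a _ = refl
coeff-addAt (b ∷ bs) (suc x) zero a _ = refl
coeff-addAt (b ∷ bs) (suc x) (suc y) a x≢y = coeff-addAt bs x y a x≢y

dot-ge : ∀ as v x y z → (x ≡ᵇ y) ≡ false → v x ≡ v y + z →
  dot (addAt y (coeff x as) as) (v [ x ≔ z ]) ≡ dot as v
dot-ge as v x y z x≢y vx = +-cancelʳ-≡ (k * z) _ _ (begin
  dot (addAt y k as) v' + k * z       ≡⟨ cong (_+ k * z) (trans (dot-addAt as v' y k) (cong (λ t → dot as v' + k * t) (not-updated v x y z x≢y))) ⟩
  dot as v' + k * v y + k * z         ≡⟨ trans (+-assoc (dot as v') _ _) (cong (dot as v' +_) (trans (sym (*-distribˡ-+ k (v y) z)) (cong (k *_) (sym vx)))) ⟩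
  dot as v' + k * v x                 ≡⟨ dot-update as v x z ⟩
  dot as v + k * z                    ∎)
  where
  open ≡-Reasoning
  k = coeff x as
  v' = v [ x ≔ z ]

dot-shift : ∀ as v x z → v x ≡ suc z → coeff x as + dot as (v [ x ≔ z ]) ≡ dot as v
dot-shift as v x z vx = +-cancelʳ-≡ (k * z) _ _ (begin
  k + dot as v' + k * z   ≡⟨ ring k (dot as v') z ⟩
  dot as v' + k * suc z   ≡⟨ cong (λ t → dot as v' + k * t) vx ⟨
  dot as v' + k * v x     ≡⟨ dot-update as v x z ⟩
  dot as v + k * z        ∎)
  where
  open ≡-Reasoning
  k = coeff x as
  v' = v [ x ≔ z ]
  ring : ∀ k d z → k + d + k * z ≡ d + k * suc z
  ring = solve-∀

dot-near : ∀ as v x y z → (x ≡ᵇ y) ≡ false → v x ≡ v y + z →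
  dot (zeroAt x (addAt y (coeff x as) as)) v + coeff x as * z ≡ dot as v
dot-near as v x y z x≢y vx = +-cancelʳ-≡ (k * v y) _ _ (begin
  dot (zeroAt x bs) v + k * z + k * v y     ≡⟨ ring (dot (zeroAt x bs) v) k z (v y) ⟩
  dot (zeroAt x bs) v + k * (v y + z)       ≡⟨ cong (λ t → dot (zeroAt x bs) v + k * t) vx ⟨
  dot (zeroAt x bs) v + k * v x             ≡⟨ cong (λ t → dot (zeroAt x bs) v + t * v x) (coeff-addAt as x y k x≢y) ⟨
  dot (zeroAt x bs) v + coeff x bs * v x    ≡⟨ dot-zeroAt bs v x ⟩
  dot bs v                                  ≡⟨ dot-addAt as v y k ⟩
  dot as v + k * v y                        ∎)
  where
  open ≡-Reasoning
  k = coeff x as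
  bs = addAt y k as
  ring : ∀ d k z t → d + k * z + k * t ≡ d + k * (t + z)
  ring = solve-∀

-- The last two arguments are the values after the substitution. In `largeNears` the entry of `X` at
-- `x` stays although its coefficients become 0, so that all entries of `X` remain large.
data Agrees (X ρ : Env) : Subst → Env → Env → Set where
  vanishes : ∀ {x} → ρ x ≡ 0 → Agrees X ρ (vanish x) X ρ
  shifts : ∀ {x z} → ρ x ≡ suc z → Agrees X ρ (shift x) X (ρ [ x ≔ z ])
  smallGes : ∀ {x y z} → (x ≡ᵇ y) ≡ false → ρ x ≡ ρ y + z → Agrees X ρ (smallGe x y) X (ρ [ x ≔ z ])
  smallGts : ∀ {x y z} → (x ≡ᵇ y) ≡ false → ρ x ≡ ρ y + suc z → Agrees X ρ (smallGt x y) X (ρ [ x ≔ z ])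
  largeGes : ∀ {x y z} → (x ≡ᵇ y) ≡ false → X x ≡ X y + z → Agrees X ρ (largeGe x y) (X [ x ≔ z ]) ρ
  largeNears : ∀ {x y z} → (x ≡ᵇ y) ≡ false → X x ≡ X y + z → Agrees X ρ (largeNear x y) X (z ◂ ρ)

addAt-zero : ∀ y v as → dot (addAt y 0 as) v ≡ dot as v
addAt-zero y v as = trans (dot-addAt as v y 0) (+-identityʳ _)

small-moveGe : ∀ d X ρ y L c S → exponent X ρ (moveGe d y L c S) ≡ dot L X + (c + dot (addAt y d S) ρ)
small-moveGe zero X ρ y L c S = cong (λ t → dot L X + (c + t)) (sym (addAt-zero y ρ S))
small-moveGe (suc d) X ρ y L c S = refl

small-moveGt : ∀ d X ρ y L c S → exponent X ρ (moveGt d y L c S) ≡ dot L X + (d + c + dot (addAt y d S) ρ)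
small-moveGt zero X ρ y L c S = cong (λ t → dot L X + (c + t)) (sym (addAt-zero y ρ S))
small-moveGt (suc d) X ρ y L c S = refl

exponent-apply : ∀ {X ρ σ X' ρ'} f → Agrees X ρ σ X' ρ' → exponent X' ρ' (apply σ f) ≡ exponent X ρ f
exponent-apply {X} {ρ} (form L c S) (vanishes {x} eq) = cong (λ t → dot L X + (c + t))
  (trans (sym (+-identityʳ _)) (trans (cong (dot (zeroAt x S) ρ +_) (sym (trans (cong (coeff x S *_) eq) (*-zeroʳ (coeff x S))))) (dot-zeroAt S ρ x)))
exponent-apply {X} {ρ} (form L c S) (shifts {x} {z} eq) = cong (dot L X +_)
  (trans (swap (coeff x S) c _) (cong (c +_) (dot-shift S ρ x z eq)))
  where
  swap : ∀ a b c → a + b + c ≡ b + (a + c)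
  swap = solve-∀
exponent-apply {X} {ρ} (form L c S) (smallGes {x} {y} {z} x≢y eq) =
  trans (small-moveGe (coeff x S) X _ y L c S) (cong (λ t → dot L X + (c + t)) (dot-ge S ρ x y z x≢y eq))
exponent-apply {X} {ρ} (form L c S) (smallGts {x} {y} {z} x≢y eq) =
  trans (small-moveGt k X _ y L c S) (cong (dot L X +_) (begin
    k + c + dot (addAt y k S) (ρ [ x ≔ z ])               ≡⟨ cong (k + c +_) (trans (dot-addAt S _ y k) (cong (λ t → dot S _ + k * t) (not-updated ρ x y z x≢y))) ⟩
    k + c + (dot S (ρ [ x ≔ z ]) + k * ρ y)               ≡⟨ +-cancelʳ-≡ (k * z) _ _ (begin
      k + c + (dot S (ρ [ x ≔ z ]) + k * ρ y) + k * z     ≡⟨ ring k c (dot S (ρ [ x ≔ z ])) (ρ y) z ⟩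
      c + (dot S (ρ [ x ≔ z ]) + k * (ρ y + suc z))       ≡⟨ cong (λ t → c + (dot S (ρ [ x ≔ z ]) + k * t)) eq ⟨
      c + (dot S (ρ [ x ≔ z ]) + k * ρ x)                 ≡⟨ cong (c +_) (dot-update S ρ x z) ⟩
      c + (dot S ρ + k * z)                               ≡⟨ +-assoc c _ _ ⟨
      c + dot S ρ + k * z                                 ∎) ⟩
    c + dot S ρ                                           ∎))
  where
  open ≡-Reasoning
  k = coeff x S
  ring : ∀ k c d y z → k + c + (d + k * y) + k * z ≡ c + (d + k * (y + suc z))
  ring = solve-∀
exponent-apply {X} {ρ} (form L c S) (largeGes {x} {y} {z} x≢y eq) = cong (_+ (c + dot S ρ)) (dot-ge L X x y z x≢y eq)
exponent-apply {X} {ρ} (form L c S) (largeNears {x} {y} {z} x≢y eq) =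
  trans (rearrange (dot (zeroAt x (addAt y (coeff x L) L)) X) c (coeff x L * z) (dot S ρ)) (cong (_+ (c + dot S ρ)) (dot-near L X x y z x≢y eq))
  where
  rearrange : ∀ a b c d → a + (b + (c + d)) ≡ a + c + (b + d)
  rearrange = solve-∀

value-apply : ∀ {X ρ σ X' ρ'} g → Agrees X ρ σ X' ρ' → value X' ρ' (applyG σ g) ≡ value X ρ g
value-apply [] _ = refl
value-apply (f ∷ fs) agr = cong₂ (λ e v → 2 ^ e + v) (exponent-apply f agr) (value-apply fs agr)

digits-apply : ∀ {X ρ σ X' ρ'} gs → Agrees X ρ σ X' ρ' → digits X' ρ' (applyGs σ gs) ≡ digits X ρ gs
digits-apply [] _ = refl
digits-apply (g ∷ gs) agr = cong₂ (λ v d → s v + d) (value-apply g agr) (digits-apply gs agr)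

-- Case distinctions cover all values of the variables

∧-true : ∀ {a b} → a ∧ b ≡ true → a ≡ true × b ≡ true
∧-true {true} {true} _ = refl , refl

onZero-sound : ∀ cap x gs → Exceeds cap (applyGs (vanish x) gs) → Exceeds cap (applyGs (shift x) gs) → Exceeds cap gs
onZero-sound cap x gs p q T = proj₁ (p T) ⊔ proj₁ (q T) , cover
  where
  cover : ∀ X ρ → (∀ i → ρ i < T) → (∀ i → proj₁ (p T) ⊔ proj₁ (q T) ≤ X i) → cap < digits X ρ gs
  cover X ρ ρ< X≥ with ρ x in eq
  ... | zero = subst (cap <_) (digits-apply gs (vanishes eq))
    (proj₂ (p T) X ρ ρ< (λ i → m⊔n≤o⇒m≤o _ _ (X≥ i)))
  ... | suc z = subst (cap <_) (digits-apply gs (shifts eq))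
    (proj₂ (q T) X (ρ [ x ≔ z ]) (update-all {_< T} ρ x z ρ< (<-trans (n<1+n z) (subst (_< T) eq (ρ< x)))) (λ i → m⊔n≤o⇒n≤o (proj₁ (p T)) _ (X≥ i)))

≡ᵇ-false-sym : ∀ x y → (x ≡ᵇ y) ≡ false → (y ≡ᵇ x) ≡ false
≡ᵇ-false-sym zero (suc y) _ = refl
≡ᵇ-false-sym (suc x) zero _ = refl
≡ᵇ-false-sym (suc x) (suc y) eq = ≡ᵇ-false-sym x y eq

onSmall-sound : ∀ cap x y gs → (x ≡ᵇ y) ≡ false →
  Exceeds cap (applyGs (smallGe x y) gs) → Exceeds cap (applyGs (smallGt y x) gs) → Exceeds cap gs
onSmall-sound cap x y gs x≢y p q T = proj₁ (p T) ⊔ proj₁ (q T) , cover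
  where
  cover : ∀ X ρ → (∀ i → ρ i < T) → (∀ i → proj₁ (p T) ⊔ proj₁ (q T) ≤ X i) → cap < digits X ρ gs
  cover X ρ ρ< X≥ with ρ y ≤? ρ x
  ... | yes y≤x = subst (cap <_) (digits-apply gs (smallGes x≢y (sym (m+[n∸m]≡n y≤x))))
    (proj₂ (p T) X _ (update-all {_< T} ρ x _ ρ< (≤-<-trans (m∸n≤m (ρ x) (ρ y)) (ρ< x))) (λ i → m⊔n≤o⇒m≤o _ _ (X≥ i)))
  ... | no y≰x = subst (cap <_) (digits-apply gs (smallGts (≡ᵇ-false-sym x y x≢y) (sym (trans (+-suc (ρ x) _) (m+[n∸m]≡n (≰⇒> y≰x))))))
    (proj₂ (q T) X _ (update-all {_< T} ρ y _ ρ< (≤-<-trans (m∸n≤m (ρ y) (suc (ρ x))) (ρ< y))) (λ i → m⊔n≤o⇒n≤o (proj₁ (p T)) _ (X≥ i)))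

onLarge-sound : ∀ cap x y gs → (x ≡ᵇ y) ≡ false →
  Exceeds cap (applyGs (largeGe x y) gs) → Exceeds cap (applyGs (largeGe y x) gs) →
  Exceeds cap (applyGs (largeNear x y) gs) → Exceeds cap (applyGs (largeNear y x) gs) → Exceeds cap gs
onLarge-sound cap x y gs x≢y p q n n' T = G , cover
  where
  -- A difference too small for the far branches is below this bound, as are the old small
  -- variables. The near branches are therefore used with `near` in place of `T`, which is possible
  -- because `Ev` allows every bound.
  near = suc (proj₁ (p T) ⊔ proj₁ (q T) ⊔ T)
  G = proj₁ (p T) ⊔ proj₁ (q T) ⊔ (proj₁ (n near) ⊔ proj₁ (n' near))
  T≤near : T ≤ near
  T≤near = m≤n⇒m≤1+n (m≤n⊔m (proj₁ (p T) ⊔ proj₁ (q T)) T)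
  cover : ∀ X ρ → (∀ i → ρ i < T) → (∀ i → G ≤ X i) → cap < digits X ρ gs
  cover X ρ ρ< X≥ = settle (X y ≤? X x)
    where
    G₁ : ∀ i → proj₁ (p T) ≤ X i
    G₁ i = m⊔n≤o⇒m≤o _ _ (m⊔n≤o⇒m≤o _ _ (X≥ i))
    G₂ : ∀ i → proj₁ (q T) ≤ X i
    G₂ i = m⊔n≤o⇒n≤o (proj₁ (p T)) _ (m⊔n≤o⇒m≤o _ _ (X≥ i))
    G₃ : ∀ i → proj₁ (n near) ≤ X i
    G₃ i = m⊔n≤o⇒m≤o _ _ (m⊔n≤o⇒n≤o (proj₁ (p T) ⊔ proj₁ (q T)) _ (X≥ i))
    G₄ : ∀ i → proj₁ (n' near) ≤ X i
    G₄ i = m⊔n≤o⇒n≤o (proj₁ (n near)) _ (m⊔n≤o⇒n≤o (proj₁ (p T) ⊔ proj₁ (q T)) _ (X≥ i))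
    small< : ∀ {z} → z < near → ∀ i → (z ◂ ρ) i < near
    small< z< zero = z<
    small< z< (suc i) = ≤-trans (ρ< i) T≤near
    settle : _ → cap < digits X ρ gs
    settle (yes y≤x) with proj₁ (p T) ≤? X x ∸ X y
    ... | yes far = subst (cap <_) (digits-apply gs (largeGes x≢y (sym (m+[n∸m]≡n y≤x))))
      (proj₂ (p T) _ ρ ρ< (update-all {proj₁ (p T) ≤_} X x _ G₁ far))
    ... | no close = subst (cap <_) (digits-apply gs (largeNears x≢y (sym (m+[n∸m]≡n y≤x))))
      (proj₂ (n near) X _ (small< (<-trans (≰⇒> close) (s≤s (≤-trans (m≤m⊔n _ _) (m≤m⊔n _ _))))) G₃)
    settle (no y≰x) with proj₁ (q T) ≤? X y ∸ X x
    ... | yes far = subst (cap <_) (digits-apply gs (largeGes (≡ᵇ-false-sym x y x≢y) (sym (m+[n∸m]≡n (≰⇒≥ y≰x)))))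
      (proj₂ (q T) _ ρ ρ< (update-all {proj₁ (q T) ≤_} X y _ G₂ far))
    ... | no close = subst (cap <_) (digits-apply gs (largeNears (≡ᵇ-false-sym x y x≢y) (sym (m+[n∸m]≡n (≰⇒≥ y≰x)))))
      (proj₂ (n' near) X _ (small< (<-trans (≰⇒> close) (s≤s (≤-trans (m≤n⊔m (proj₁ (p T)) _) (m≤m⊔n _ _))))) G₄)

check-sound : ∀ n cap gs → check n cap gs ≡ true → Exceeds cap gs
checkResult-sound : ∀ n r {P} → checkResult n r ≡ true → Establishes r P → Ev P
checkSplit-sound : ∀ n cap sp gs → checkSplit n cap sp gs ≡ true → Exceeds cap gs
check-sound (suc n) cap gs eq =
  checkResult-sound n (reduce cap 0 none [] gs) eq (reduce-sound cap 0 none [] gs (always λ _ _ → z≤n))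
checkResult-sound n refuted eq est = est
checkResult-sound n (unresolved cap (choice _ f g) gs) eq est = est (checkSplit-sound n cap (split f g) gs eq)
checkSplit-sound n cap (onZero x) gs eq with ∧-true eq
... | e₁ , e₂ = onZero-sound cap x gs (check-sound n cap _ e₁) (check-sound n cap _ e₂)
checkSplit-sound n cap (onSmall x y) gs eq with x ≡ᵇ y in x≢y
... | false with ∧-true eq
...   | e₁ , e₂ = onSmall-sound cap x y gs x≢y (check-sound n cap _ e₁) (check-sound n cap _ e₂)
checkSplit-sound n cap (onLarge x y) gs eq with x ≡ᵇ y in x≢y
... | false with ∧-true eq
...   | e₁ , eq' with ∧-true eq'
...     | e₂ , eq'' with ∧-true eq''
...       | e₃ , e₄ = onLarge-sound cap x y gs x≢y
  (check-sound n cap _ e₁) (check-sound n cap _ e₂) (check-sound n cap _ e₃) (check-sound n cap _ e₄)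

-- The square of a number given by its gaps

-- The gaps are read from the lowest digit upwards, and the number is odd.
fromGaps : List ℕ → ℕ
fromGaps [] = 1
fromGaps (g ∷ gs) = 1 + 2 ^ suc g * fromGaps gs

-- The value `a` is arbitrary, since its coefficient in `bits κ` is 0.
data Realises : Env → Env → List Bool → List ℕ → Set where
  nil   : ∀ {X ρ} → Realises X ρ [] []
  large : ∀ {X ρ κ g gs a} → Realises X ρ κ gs → Realises (g ◂ X) (a ◂ ρ) (true ∷ κ) (g ∷ gs)
  small : ∀ {X ρ κ g gs a} → Realises X ρ κ gs → Realises (a ◂ X) (g ◂ ρ) (false ∷ κ) (g ∷ gs)

dot-zeros : ∀ κ v → dot (zeros κ) v ≡ 0
dot-zeros [] v = refl
dot-zeros (_ ∷ κ) v = dot-zeros κ (v ∘ suc)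

value-prepend : ∀ {X ρ X' ρ'} b g → (∀ f → exponent X' ρ' (prepend b f) ≡ suc g + exponent X ρ f) →
  ∀ fs → value X' ρ' (map (prepend b) fs) ≡ 2 ^ suc g * value X ρ fs
value-prepend b g e≡ [] = sym (*-zeroʳ (2 ^ suc g))
value-prepend {X} {ρ} b g e≡ (f ∷ fs) = trans
  (cong₂ _+_ (trans (cong (2 ^_) (e≡ f)) (^-distribˡ-+-* 2 (suc g) _)) (value-prepend b g e≡ fs))
  (sym (*-distribˡ-+ (2 ^ suc g) _ (value X ρ fs)))

value-bits : ∀ {X ρ κ gs} → Realises X ρ κ gs → value X ρ (bits κ) ≡ fromGaps gs
value-bits nil = refl
value-bits {X} {ρ} {κ} (large {X'} {ρ'} {κ'} {g} {a = a} r) = cong₂ (λ e v → 2 ^ e + v)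
  (cong₂ _+_ (dot-zeros κ X) (dot-zeros κ ρ))
  (trans (value-prepend {X'} {ρ'} {g ◂ X'} {a ◂ ρ'} true g (λ { (form L c S) → ring g (dot L X') c (dot S ρ') }) (bits κ')) (cong (2 ^ suc g *_) (value-bits r)))
  where
  ring : ∀ g l c s → 1 * g + l + (suc c + s) ≡ suc g + (l + (c + s))
  ring = solve-∀
value-bits {X} {ρ} {κ} (small {X'} {ρ'} {κ'} {g} {a = a} r) = cong₂ (λ e v → 2 ^ e + v)
  (cong₂ _+_ (dot-zeros κ X) (dot-zeros κ ρ))
  (trans (value-prepend {X'} {ρ'} {a ◂ X'} {g ◂ ρ'} false g (λ { (form L c S) → ring g (dot L X') c (dot S ρ') }) (bits κ')) (cong (2 ^ suc g *_) (value-bits r)))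
  where
  ring : ∀ g l c s → l + (suc c + (1 * g + s)) ≡ suc g + (l + (c + s))
  ring = solve-∀

dot-⊕ : ∀ as bs v → dot (as ⊕ bs) v ≡ dot as v + dot bs v
dot-⊕ [] bs v = refl
dot-⊕ (a ∷ as) [] v = sym (+-identityʳ _)
dot-⊕ (a ∷ as) (b ∷ bs) v = trans (cong ((a + b) * v 0 +_) (dot-⊕ as bs (v ∘ suc))) (ring a b (v 0) _ _)
  where
  ring : ∀ a b t p q → (a + b) * t + (p + q) ≡ a * t + p + (b * t + q)
  ring = solve-∀

exponent-⊞ : ∀ X ρ f g → exponent X ρ (f ⊞ g) ≡ exponent X ρ f + exponent X ρ g
exponent-⊞ X ρ (form L c S) (form L' c' S') =
  trans (cong₂ (λ l s → l + (c + c' + s)) (dot-⊕ L L' X) (dot-⊕ S S' ρ)) (ring (dot L X) (dot L' X) c c' _ _)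
  where
  ring : ∀ l l' c c' s s' → l + l' + (c + c' + (s + s')) ≡ l + (c + s) + (l' + (c' + s'))
  ring = solve-∀

power-⊞ : ∀ X ρ f g → 2 ^ exponent X ρ (f ⊞ g) ≡ 2 ^ exponent X ρ f * 2 ^ exponent X ρ g
power-⊞ X ρ f g = trans (cong (2 ^_) (exponent-⊞ X ρ f g)) (^-distribˡ-+-* 2 (exponent X ρ f) _)

value-++ : ∀ X ρ fs gs → value X ρ (fs ++ gs) ≡ value X ρ fs + value X ρ gs
value-++ X ρ [] gs = refl
value-++ X ρ (f ∷ fs) gs = trans (cong (2 ^ exponent X ρ f +_) (value-++ X ρ fs gs)) (sym (+-assoc (2 ^ exponent X ρ f) _ _))

value-cross : ∀ X ρ f gs → value X ρ (map (λ g → bump (f ⊞ g)) gs) ≡ 2 * (2 ^ exponent X ρ f * value X ρ gs)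
value-cross X ρ f [] = cong (2 *_) (sym (*-zeroʳ (2 ^ exponent X ρ f)))
value-cross X ρ f (g ∷ gs) = trans
  (cong₂ _+_ (trans (cong (2 ^_) (exponent-bump X ρ (f ⊞ g))) (cong (2 *_) (power-⊞ X ρ f g))) (value-cross X ρ f gs))
  (ring (2 ^ exponent X ρ f) _ (value X ρ gs))
  where
  ring : ∀ a b c → 2 * (a * b) + 2 * (a * c) ≡ 2 * (a * (b + c))
  ring = solve-∀

value-square : ∀ X ρ fs → value X ρ (square fs) ≡ value X ρ fs * value X ρ fs
value-square X ρ [] = refl
value-square X ρ (f ∷ fs) = trans
  (cong₂ _+_ (power-⊞ X ρ f f) (trans (value-++ X ρ (map (λ g → bump (f ⊞ g)) fs) (square fs))
    (cong₂ _+_ (value-cross X ρ f fs) (value-square X ρ fs))))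
  (ring (2 ^ exponent X ρ f) (value X ρ fs))
  where
  ring : ∀ a b → a * a + (2 * (a * b) + b * b) ≡ (a + b) * (a + b)
  ring = solve-∀

-- Detaching groups without carries

valueMax : ℕ → Group → ℕ
valueMax T [] = 0
valueMax T (f ∷ fs) = 2 ^ smallMax T f + valueMax T fs

value-partition : ∀ u X ρ g → value X ρ g ≡
  2 ^ dot u X * value X ρ (proj₁ (partition u g)) + value X ρ (proj₂ (partition u g))
value-partition u X ρ [] = cong (_+ 0) (sym (*-zeroʳ (2 ^ dot u X)))
value-partition u X ρ (form L c S ∷ fs) with compareV L u in L≡u | partition u fs | value-partition u X ρ fs
... | before | es , os | ih = trans (cong (2 ^ (dot L X + (c + dot S ρ)) +_) ih) (exchange (2 ^ dot u X * value X ρ es) _ (value X ρ os))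
... | after | es , os | ih = trans (cong (2 ^ (dot L X + (c + dot S ρ)) +_) ih) (exchange (2 ^ dot u X * value X ρ es) _ (value X ρ os))
... | same | es , os | ih rewrite compareV-same L u L≡u = trans
  (cong₂ _+_ (^-distribˡ-+-* 2 (dot u X) (c + dot S ρ)) ih) (ring (2 ^ dot u X) _ (value X ρ es) (value X ρ os))
  where
  ring : ∀ a b c d → a * b + (a * c + d) ≡ a * (b + c) + d
  ring = solve-∀

value-partition-≤ : ∀ u T X ρ g → (∀ i → ρ i < T) →
  value X ρ (proj₁ (partition u g)) ≤ valueMax T (proj₁ (partition u g))
value-partition-≤ u T X ρ [] ρ< = z≤n
value-partition-≤ u T X ρ (form L c S ∷ fs) ρ< with compareV L u | partition u fs | value-partition-≤ u T X ρ fs ρ<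
... | before | _ | ih = ih
... | after | _ | ih = ih
... | same | _ | ih = +-mono-≤ (^-monoʳ-≤ 2 (+-monoʳ-≤ c (dot-mono S (λ i → <⇒≤ (ρ< i))))) ih

allAbove-sound : ∀ u fs X ρ G → (∀ i → G ≤ X i) → allAbove u fs ≡ true → All (λ f → dot u X + G ≤ exponent X ρ f) fs
allAbove-sound u [] X ρ G X≥ _ = []
allAbove-sound u (form L c S ∷ fs) X ρ G X≥ eq with ∧-true eq
... | u<L , rest = ≤-trans (<V-sound u L X G X≥ u<L) (m≤m+n _ _) ∷ allAbove-sound u fs X ρ G X≥ rest

allBelow-sound : ∀ u fs T X ρ G → (∀ i → ρ i < T) → (∀ i → G ≤ X i) → allBelow u fs ≡ true →
  value X ρ fs * 2 ^ G ≤ 2 ^ dot u X * valueMax T fs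
allBelow-sound u [] T X ρ G ρ< X≥ _ = z≤n
allBelow-sound u (f@(form L c S) ∷ fs) T X ρ G ρ< X≥ eq with ∧-true eq
... | L<u , rest = begin
  (2 ^ exponent X ρ f + value X ρ fs) * 2 ^ G                    ≡⟨ *-distribʳ-+ (2 ^ G) (2 ^ exponent X ρ f) _ ⟩
  2 ^ exponent X ρ f * 2 ^ G + value X ρ fs * 2 ^ G              ≤⟨ +-mono-≤ first (allBelow-sound u fs T X ρ G ρ< X≥ rest) ⟩
  2 ^ dot u X * 2 ^ smallMax T f + 2 ^ dot u X * valueMax T fs   ≡⟨ *-distribˡ-+ (2 ^ dot u X) _ (valueMax T fs) ⟨
  2 ^ dot u X * (2 ^ smallMax T f + valueMax T fs)               ∎
  where
  open ≤-Reasoning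
  swap : ∀ a b c → a + b + c ≡ a + c + b
  swap = solve-∀
  first : 2 ^ exponent X ρ f * 2 ^ G ≤ 2 ^ dot u X * 2 ^ smallMax T f
  first = begin
    2 ^ exponent X ρ f * 2 ^ G               ≡⟨ ^-distribˡ-+-* 2 (exponent X ρ f) G ⟨
    2 ^ (dot L X + (c + dot S ρ) + G)        ≡⟨ cong (2 ^_) (swap (dot L X) _ G) ⟩
    2 ^ (dot L X + G + (c + dot S ρ))        ≤⟨ ^-monoʳ-≤ 2 (+-mono-≤ (<V-sound L u X G X≥ L<u) (+-monoʳ-≤ c (dot-mono S (λ i → <⇒≤ (ρ< i))))) ⟩
    2 ^ (dot u X + smallMax T f)             ≡⟨ ^-distribˡ-+-* 2 (dot u X) _ ⟩
    2 ^ dot u X * 2 ^ smallMax T f           ∎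

Additive : Group → Group × Group → Env → Env → Set
Additive g (es , os) X ρ = s (value X ρ es) + s (value X ρ os) ≡ s (value X ρ g)

detach-sound : ∀ u g → Ev (Additive g (detach u g))
detach-sound u g T with partition u g | (λ X ρ → value-partition u X ρ g) | (λ X ρ → value-partition-≤ u T X ρ g)
... | es , os | decompose | es≤ with allAbove u os in above
...   | true = G , additive
  where
  -- As G < 2^G, the detached part fits into G digits, while all other forms are multiples of
  -- 2^(d+G).
  G = valueMax T es
  additive : ∀ X ρ → (∀ i → ρ i < T) → (∀ i → G ≤ X i) → Additive g (es , os) X ρ
  additive X ρ ρ< X≥ with multiple (dot u X + G) X ρ os (allAbove-sound u os X ρ G X≥ above)
  ... | m , os≡ = begin
    s V + s (value X ρ os)                 ≡⟨ cong (λ t → s V + s t) os≡ ⟩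
    s V + s (2 ^ (d + G) * m)              ≡⟨ cong (s V +_) (s-shift (d + G) m) ⟩
    s V + s m                              ≡⟨ s-split G V m (≤-<-trans (es≤ X ρ ρ<) (n<2^n G)) ⟨
    s (V + 2 ^ G * m)                      ≡⟨ s-shift d (V + 2 ^ G * m) ⟨
    s (2 ^ d * (V + 2 ^ G * m))            ≡⟨ cong s (ring (2 ^ d) V (2 ^ G) m) ⟩
    s (2 ^ d * V + 2 ^ d * 2 ^ G * m)      ≡⟨ cong (λ t → s (2 ^ d * V + t * m)) (^-distribˡ-+-* 2 d G) ⟨
    s (2 ^ d * V + 2 ^ (d + G) * m)        ≡⟨ cong (λ t → s (2 ^ d * V + t)) os≡ ⟨
    s (2 ^ d * V + value X ρ os)           ≡⟨ cong s (decompose X ρ) ⟨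
    s (value X ρ g)                        ∎
    where
    open ≡-Reasoning
    d = dot u X
    V = value X ρ es
    ring : ∀ a v p m → a * (v + p * m) ≡ a * v + a * p * m
    ring = solve-∀
...   | false with allBelow u os in belowEq
...     | false = 0 , λ X ρ _ _ → refl
...     | true = G , additive
  where
  -- With this choice `allBelow-sound` and G < 2^G keep the sum of the other forms below 2^d.
  G = valueMax T os
  additive : ∀ X ρ → (∀ i → ρ i < T) → (∀ i → G ≤ X i) → Additive g (es , os) X ρ
  additive X ρ ρ< X≥ = begin
    s V + s O              ≡⟨ +-comm (s V) (s O) ⟩
    s O + s V              ≡⟨ s-split d O V O<2ᵈ ⟨
    s (O + 2 ^ d * V)      ≡⟨ cong s (+-comm O _) ⟩
    s (2 ^ d * V + O)      ≡⟨ cong s (decompose X ρ) ⟨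
    s (value X ρ g)        ∎
    where
    open ≡-Reasoning
    d = dot u X
    V = value X ρ es
    O = value X ρ os
    O<2ᵈ : O < 2 ^ d
    O<2ᵈ = *-cancelʳ-< (2 ^ G) O (2 ^ d) (≤-<-trans (allBelow-sound u os T X ρ G ρ< X≥ belowEq)
      (*-monoʳ-< (2 ^ d) {{m^n≢0 2 d}} (n<2^n G)))

detachAll-sound : ∀ us g → Ev (λ X ρ → digits X ρ (detachAll us g) ≡ s (value X ρ g))
detachAll-sound [] g = always λ X ρ → +-identityʳ _
detachAll-sound (u ∷ us) g = ev-map₂
  (λ {X} {ρ} ih add → trans (cong (s (value X ρ (proj₁ (detach u g))) +_) ih) add)
  (detachAll-sound us (proj₂ (detach u g))) (detach-sound u g)

verify-sound : ∀ k κ → verify k κ ≡ true → Ev (λ X ρ → k < s (value X ρ (bits κ) * value X ρ (bits κ)))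
verify-sound k κ eq with k <ᵇ chain (square (bits κ)) in long
... | true = ev-map (λ {X} {ρ} ch → subst (λ v → k < s v) (value-square X ρ (bits κ)) (<-≤-trans (<ᵇ-true k _ long) ch))
  (chain-sound (square (bits κ)))
... | false = ev-map₂ (λ {X} {ρ} sum k< → subst (k <_) (trans sum (cong s (value-square X ρ (bits κ)))) k<)
  (detachAll-sound (pivots (largeParts (bits κ))) (square (bits κ)))
  (check-sound 200 k (detachAll (pivots (largeParts (bits κ))) (square (bits κ))) eq)

-- From gap patterns to finiteness

allSmall : List Bool → Bool
allSmall [] = true
allSmall (true ∷ κ) = false
allSmall (false ∷ κ) = allSmall κ

-- A pattern without large gaps means that all gaps are bounded, which is the desired conclusion, so
-- nothing has to be refuted there.
admissible : ℕ → List Bool → Bool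
admissible k κ with allSmall κ
... | true = true
... | false = verify k κ

everyKind : ℕ → (List Bool → Bool) → Bool
everyKind zero P = P []
everyKind (suc d) P = everyKind d (P ∘ (true ∷_)) ∧ everyKind d (P ∘ (false ∷_))

everyKind-sound : ∀ d P → everyKind d P ≡ true → ∀ κ → length κ ≡ d → P κ ≡ true
everyKind-sound zero P eq [] _ = eq
everyKind-sound (suc d) P eq (true ∷ κ) len = everyKind-sound d _ (proj₁ (∧-true eq)) κ (suc-injective len)
everyKind-sound (suc d) P eq (false ∷ κ) len = everyKind-sound d _ (proj₂ (∧-true {everyKind d (P ∘ (true ∷_))} eq)) κ (suc-injective len)

-- There are only 2^d patterns, so their thresholds have a common bound.
kinds-bounded : ∀ d (F : List Bool → ℕ) → ∃[ G ] (∀ κ → length κ ≡ d → F κ ≤ G)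
kinds-bounded zero F = F [] , λ { [] _ → ≤-refl }
kinds-bounded (suc d) F with kinds-bounded d (F ∘ (true ∷_)) | kinds-bounded d (F ∘ (false ∷_))
... | G , p | G' , q = G ⊔ G' , λ
  { (true ∷ κ) len → ≤-trans (p κ (suc-injective len)) (m≤m⊔n G G')
  ; (false ∷ κ) len → ≤-trans (q κ (suc-injective len)) (m≤n⊔m G G') }

Exceeded : ℕ → ℕ → Set
Exceeded k n = k < s (n * n)

admissible-sound : ∀ k κ → admissible k κ ≡ true → Ev (λ X ρ → allSmall κ ≡ false → Exceeded k (value X ρ (bits κ)))
admissible-sound k κ eq with allSmall κ
... | true = always λ { _ _ () }
... | false = ev-map (λ p _ → p) (verify-sound k κ eq)

realise : ∀ T G gs → 0 < T → All (λ g → g < T ⊎ G ≤ g) gs → ∃[ κ ] ∃[ X ] ∃[ ρ ]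
  (Realises X ρ κ gs × length κ ≡ length gs × (∀ i → ρ i < T) × (∀ i → G ≤ X i) × (allSmall κ ≡ true → All (_< T) gs))
-- Beyond the last gap the defaults `G` and 0 respect the bounds on large and small variables; the
-- latter needs `0<T`.
realise T G [] 0<T [] = [] , (λ _ → G) , (λ _ → 0) , nil , refl , (λ _ → 0<T) , (λ _ → ≤-refl) , λ _ → []
realise T G (g ∷ gs) 0<T (p ∷ ps) with realise T G gs 0<T ps | p
... | κ , X , ρ , r , len , ρ< , X≥ , all< | inj₁ g<T =
  false ∷ κ , G ◂ X , g ◂ ρ , small r , cong suc len , (λ { zero → g<T ; (suc i) → ρ< i }) , (λ { zero → ≤-refl ; (suc i) → X≥ i }) , λ eq → g<T ∷ all< eq
... | κ , X , ρ , r , len , ρ< , X≥ , all< | inj₂ G≤g =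
  true ∷ κ , g ◂ X , 0 ◂ ρ , large r , cong suc len , (λ { zero → 0<T ; (suc i) → ρ< i }) , (λ { zero → G≤g ; (suc i) → X≥ i }) , λ ()

-- Pigeonhole on thresholds

countFrom : ℕ → List ℕ → ℕ
countFrom T [] = 0
countFrom T (g ∷ gs) with T ≤? g
... | yes _ = suc (countFrom T gs)
... | no _ = countFrom T gs

countFrom-anti : ∀ {T G} → T ≤ G → ∀ gs → countFrom G gs ≤ countFrom T gs
countFrom-anti T≤G [] = z≤n
countFrom-anti {T} {G} T≤G (g ∷ gs) with T ≤? g | G ≤? g
... | yes _ | yes _ = s≤s (countFrom-anti T≤G gs)
... | yes _ | no _ = m≤n⇒m≤1+n (countFrom-anti T≤G gs)
... | no T≰g | yes G≤g = ⊥-elim (T≰g (≤-trans T≤G G≤g))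
... | no _ | no _ = countFrom-anti T≤G gs

countFrom-zero : ∀ T gs → countFrom T gs ≤ 0 → All (_< T) gs
countFrom-zero T [] _ = []
countFrom-zero T (g ∷ gs) le with T ≤? g
... | no T≰g = ≰⇒> T≰g ∷ countFrom-zero T gs le

-- A gap with T ≤ g < G counts for `T` but no longer for `G`.
separated? : ∀ {T G} → T ≤ G → ∀ gs → All (λ g → g < T ⊎ G ≤ g) gs ⊎ countFrom G gs < countFrom T gs
separated? T≤G [] = inj₁ []
separated? {T} {G} T≤G (g ∷ gs) with T ≤? g | G ≤? g | separated? T≤G gs
... | yes _ | yes G≤g | inj₁ sep = inj₁ (inj₂ G≤g ∷ sep)
... | yes _ | yes _ | inj₂ lt = inj₂ (s≤s lt)
... | yes _ | no _ | _ = inj₂ (s≤s (countFrom-anti T≤G gs))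
... | no T≰g | yes G≤g | _ = ⊥-elim (T≰g (≤-trans T≤G G≤g))
... | no T≰g | no _ | inj₁ sep = inj₁ (inj₁ (≰⇒> T≰g) ∷ sep)
... | no _ | no _ | inj₂ lt = inj₂ lt

module _ (k d : ℕ) (verified : everyKind d (admissible k) ≡ true) where

  claim : ∀ κ → Ev (λ X ρ → length κ ≡ d → allSmall κ ≡ false → Exceeded k (value X ρ (bits κ)))
  claim κ with length κ ≟ d
  ... | yes len = ev-map (λ p _ → p) (admissible-sound k κ (everyKind-sound d (admissible k) verified κ len))
  ... | no ≢d = always λ _ _ len → ⊥-elim (≢d len)

  threshold : ∀ T → ∃[ G ] (T ≤ G × (∀ κ X ρ → length κ ≡ d → (∀ i → ρ i < T) → (∀ i → G ≤ X i) →
    allSmall κ ≡ false → Exceeded k (value X ρ (bits κ))))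
  threshold T with kinds-bounded d (λ κ → proj₁ (claim κ T))
  ... | G , bounds = T ⊔ G , m≤m⊔n T G , λ κ X ρ len ρ< X≥ →
    proj₂ (claim κ T) X ρ ρ< (λ i → ≤-trans (bounds κ len) (m⊔n≤o⇒n≤o T G (X≥ i))) len

  -- Induction on the number of gaps that reach the threshold. Either no gap lies between `T` and
  -- the next threshold `G`, and the verified pattern decides, or raising `T` to `G` loses a gap.
  -- When none is left, all gaps are below the threshold.
  gaps-bounded : ∀ n T → 0 < T → ∃[ B ] (∀ gs → length gs ≡ d → countFrom T gs ≤ n →
    All (_< B) gs ⊎ Exceeded k (fromGaps gs))
  gaps-bounded zero T 0<T = T , λ gs _ le → inj₁ (countFrom-zero T gs le)
  gaps-bounded (suc n) T 0<T with threshold T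
  ... | G , T≤G , many with gaps-bounded n G (≤-trans 0<T T≤G)
  ...   | B , ih = T ⊔ B , bounded
    where
    enlarge : ∀ {gs M N} → M ≤ N → All (_< M) gs → All (_< N) gs
    enlarge M≤N [] = []
    enlarge M≤N (p ∷ ps) = ≤-trans p M≤N ∷ enlarge M≤N ps
    bounded : ∀ gs → length gs ≡ d → countFrom T gs ≤ suc n → All (_< T ⊔ B) gs ⊎ Exceeded k (fromGaps gs)
    bounded gs len le with separated? T≤G gs
    ... | inj₂ lt with ih gs len (s≤s⁻¹ (≤-trans lt le))
    ...   | inj₁ all< = inj₁ (enlarge (m≤n⊔m T B) all<)
    ...   | inj₂ lg = inj₂ lg
    bounded gs len le | inj₁ sep with realise T G gs 0<T sep
    ... | κ , X , ρ , r , lenκ , ρ< , X≥ , all< with allSmall κ in sm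
    ...   | true = inj₁ (enlarge (m≤m⊔n T B) (all< refl))
    ...   | false = inj₂ (subst (Exceeded k) (value-bits r) (many κ X ρ (trans lenκ len) ρ< X≥ sm))

fromGaps-bound : ∀ B d → ∃[ N ] (∀ gs → length gs ≡ d → All (_< B) gs → fromGaps gs ≤ N)
fromGaps-bound B zero = 1 , λ { [] _ _ → ≤-refl }
fromGaps-bound B (suc d) with fromGaps-bound B d
... | N , le = 1 + 2 ^ B * N , λ { (g ∷ gs) len (g<B ∷ all<) →
  s≤s (*-mono-≤ (^-monoʳ-≤ 2 g<B) (le gs (suc-injective len) all<)) }

countFrom-length : ∀ T gs → countFrom T gs ≤ length gs
countFrom-length T [] = z≤n
countFrom-length T (g ∷ gs) with T ≤? g
... | yes _ = s≤s (countFrom-length T gs)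
... | no _ = m≤n⇒m≤1+n (countFrom-length T gs)

-- Reading off the gaps of an odd number

halves : ∀ m → m ≡ m % 2 + 2 * (m / 2)
halves m = trans (m≡m%n+[m/n]*n m 2) (cong (m % 2 +_) (*-comm (m / 2) 2))

even⊎odd : ∀ m → m ≡ 2 * (m / 2) ⊎ m ≡ suc (2 * (m / 2))
even⊎odd m with m % 2 | m%n<n m 2 | halves m
... | 0 | _ | eq = inj₁ eq
... | 1 | _ | eq = inj₂ eq
... | suc (suc _) | s≤s (s≤s ()) | _

-- The trailing zeros of `m` form the first gap of the odd number 2m + 1, so stripping zeros and
-- stripping a one alternate.
decode : ∀ m → Acc _<_ m → 0 < m → ∃[ z ] ∃[ gs ] (m ≡ 2 ^ z * fromGaps gs × s m ≡ suc (length gs))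
decode-odd : ∀ m → Acc _<_ m → ∃[ gs ] (suc (2 * m) ≡ fromGaps gs × s (suc (2 * m)) ≡ suc (length gs))
decode-odd zero _ = [] , refl , refl
decode-odd m@(suc _) a with decode m a (s≤s z≤n)
... | z , gs , m≡ , sm = z ∷ gs , cong suc (trans (cong (2 *_) m≡) (sym (*-assoc 2 (2 ^ z) _))) ,
  trans (s-suc-double m) (cong suc sm)
decode m@(suc _) (acc rs) _ with even⊎odd m
... | inj₂ m≡ with decode-odd (m / 2) (rs (m/n<m m 2 (s≤s (s≤s z≤n))))
...   | gs , val≡ , s≡ = 0 , gs , trans m≡ (trans val≡ (sym (*-identityˡ _))) , trans (cong s m≡) s≡
decode m@(suc _) (acc rs) _ | inj₁ m≡ with decode (m / 2) (rs (m/n<m m 2 (s≤s (s≤s z≤n)))) half>0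
  where
  half>0 : 0 < m / 2
  half>0 = n≢0⇒n>0 λ h → 1+n≢0 (trans m≡ (cong (2 *_) h))
... | z , gs , half≡ , s≡ = suc z , gs ,
  trans m≡ (trans (cong (2 *_) half≡) (sym (*-assoc 2 (2 ^ z) _))) ,
  trans (cong s m≡) (trans (s-double (m / 2)) s≡)

finite : ∀ d → everyKind d (admissible (suc d)) ≡ true →
  ∃[ B ] (∀ n → n % 2 ≡ 1 → s n ≡ suc d → s (n * n) ≡ suc d → n < B)
-- With `d` gaps the threshold 1 has to be raised at most `d` times.
finite d verified with gaps-bounded (suc d) d verified d 1 (s≤s z≤n)
... | B , gaps with fromGaps-bound B d
...   | N , le = suc N , bound
  where
  bound : ∀ n → n % 2 ≡ 1 → s n ≡ suc d → s (n * n) ≡ suc d → n < suc N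
  bound n odd sn snn with decode-odd (n / 2) (<-wellFounded _)
  ... | gs , val≡ , s≡ = conclude (gaps gs len (≤-trans (countFrom-length 1 gs) (≤-reflexive len)))
    where
    n≡ : n ≡ fromGaps gs
    n≡ = trans (trans (halves n) (cong (_+ 2 * (n / 2)) odd)) val≡
    len : length gs ≡ d
    len = suc-injective (trans (sym s≡) (trans (cong s (trans val≡ (sym n≡))) sn))
    conclude : All (_< B) gs ⊎ Exceeded (suc d) (fromGaps gs) → n < suc N
    conclude (inj₁ all<) = s≤s (subst (_≤ N) (sym n≡) (le gs len all<))
    conclude (inj₂ many) = ⊥-elim (<-irrefl (sym snn) (subst (Exceeded (suc d)) (sym n≡) many))

theorem1 : (k : ℕ) → (k ≡ 9 ⊎ k ≡ 10 ⊎ k ≡ 11) →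
    ∃[ B ] ((n : ℕ) → n % 2 ≡ 1 → s n ≡ k → s (n * n) ≡ k → n < B)
-- A number with k ones has k - 1 gaps. The second `refl` evaluates the search on all 2^(k-1)
-- patterns.
theorem1 _ (inj₁ refl) = finite 8 refl
theorem1 _ (inj₂ (inj₁ refl)) = finite 9 refl
theorem1 _ (inj₂ (inj₂ refl)) = finite 10 refl
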